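{- Let $T$ be a tree of order at least $6$. Then $T\in\mathcal{O}$ if and only if either $T\in\mathcal{O}'$, or there is a matching $M$ in $T$ such that every component of $T\mp M$ belongs to $\mathcal{O}'$.
   Context: For a matching $M$ in a graph $G$, $G\mp M$ denotes the graph obtained from $G-M$ (delete the edges of $M$) by attaching exactly one new pendant edge (to a new leaf) at each vertex covered by $M$. Family $\mathcal{O}$ (labeled trees, each vertex has status $A$ or $B$): it contains the path $P_6$ whose two central vertices have status $A$ and other four vertices status $B$; and it is closed under: Operation $\mathcal{O}_1$: for a path $xyz$ with $x,y$ of status $B$ and $z$ of status $A$, add a new path $abc$ and edge $za$ with statuses $a\colon A$, $b\colon B$, $c\colon B$; Operation $\mathcal{O}_2$: for an edge $xy$ with $x,y$ of status $B$, add a new path $abcd$ and edge $dx$ with statuses $a\colon B$, $b\colon B$, $c\colon A$, $d\colon A$. An unlabeled tree is in $\mathcal{O}$ if it is the underlying tree of a labeled tree in $\mathcal{O}$. $2$-subdivision: let $G$ be a connected graph of order at least $2$ and $\mathcal{P}=\{\mathcal{P}(v):v\in V(G)\}$ where $\mathcal{P}(v)$ is a partition of $N_G(v)$ (into nonempty blocks). $G(\mathcal{P})$ has vertex set $V(G)\cup(V(G)\times\{1\})\cup\bigcup_{v\in V(G)}(\{v\}\times\mathcal{P}(v))$ and edge set $E_1\cup E_2\cup E_3$, where $E_1=\{v(v,1):v\in V(G)\}$, $E_2=\{v(v,A): v\in V(G), A\in\mathcal{P}(v)\}$, and $E_3=\{(u,A)(v,B): uv\in E(G), A\in\mathcal{P}(u),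 B\in\mathcal{P}(v), v\in A, u\in B\}$. $\mathcal{O}'$ is the family of all trees isomorphic to some $R(\mathcal{P})$ where $R$ is a tree of order at least $2$ and $\mathcal{P}$ is such a family of partitions. -}

module Defs where

open import Data.Empty using (⊥)
open import Data.Fin.Base using (Fin; zero; suc; toℕ; fromℕ; inject₁)
open import Data.Fin.Patterns using (0F; 3F)
open import Data.Nat.Base using (ℕ; suc; _≤_)
open import Data.Nat.Properties using (1+n≢n)
open import Data.Product.Base using (Σ-syntax; ∃-syntax; _×_; _,_)
open import Data.Refinement using (Refinement-syntax; value)
open import Data.Sum.Base using (_⊎_; inj₁; inj₂; [_,_])
open import Data.Vec.Base using (Vec; []; _∷_; lookup)
open import Function.Bundles using (_↔_; _⇔_; module Inverse)
open import Function.Definitions using (Injective)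
open import Level using (0ℓ)
open import Relation.Binary.Construct.Closure.ReflexiveTransitive using (Star)
open import Relation.Binary.Construct.Closure.Symmetric using (SymClosure; fwd; bwd; symmetric)
open import Relation.Binary.Core using (Rel; _⇒_)
open import Relation.Binary.Definitions using (Symmetric; Irreflexive; Decidable)
open import Relation.Binary.PropositionalEquality.Core using (_≡_; refl)
open import Relation.Nullary.Negation.Core using (¬_)
open import Relation.Unary using (Pred; Satisfiable)

-- Simple graphs.  An edge uv is the fact u ~ v; different proofs of u ~ v
-- are not different edges.
record Graph : Set₁ where
  infix 4 _~_
  field
    V        : Set
    _~_      : Rel V 0ℓ
    ~-sym    : Symmetric _~_
    ~-irrefl : Irreflexive _≡_ _~_

open Graph using (V)

record Finite (G : Graph) : Set where
  open Graph G using (_~_)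
  field
    order    : ℕ
    vertices : V G ↔ Fin order
    _~?_     : Decidable _~_

record _≅_ (G H : Graph) : Set where
  private
    module G = Graph G
    module H = Graph H
  field
    bijection : V G ↔ V H
  open Inverse bijection public using (to; from)
  field
    ~-iff : ∀ {u v} → u G.~ v ⇔ to u H.~ to v

infix 4 _≅_

Reachable : (G : Graph) → Rel (V G) 0ℓ
Reachable G = Star (Graph._~_ G)

record Connected (G : Graph) : Set where
  field
    nonempty  : V G
    reachable : ∀ u v → Reachable G u v

-- A cycle v₀ v₁ … vₘ, of length 1 + m ≥ 3.
record Cycle (G : Graph) : Set where
  open Graph G using (_~_)
  field
    m         : ℕ
    2≤m       : 2 ≤ m
    vertex    : Fin (suc m) → V G
    injective : Injective _≡_ _≡_ vertex
    step      : ∀ (i : Fin m) → vertex (inject₁ i) ~ vertex (suc i)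
    close     : vertex (fromℕ m) ~ vertex zero

record IsTree (G : Graph) : Set where
  field
    connected : Connected G
    acyclic   : ¬ Cycle G

-- The refinement type carries its reachability proof irrelevantly, so each
-- vertex occurs once however many walks lead to it.
component : (G : Graph) → V G → Graph
component G r = record
  { V        = [ u ∈ V G ∣ Reachable G r u ]
  ; _~_      = λ u v → value u ~ value v
  ; ~-sym    = ~-sym
  ; ~-irrefl = λ { refl → ~-irrefl refl }
  }
  where open Graph G using (_~_; ~-sym; ~-irrefl)

EveryComponent : ∀ {ℓ} → (Graph → Set ℓ) → Graph → Set ℓ
EveryComponent P G = ∀ (r : V G) → P (component G r)

record Matching (G : Graph) : Set₁ where
  open Graph G using (_~_)
  field
    Edge     : Rel (V G) 0ℓ
    Edge?    : Decidable Edge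
    Edge-sym : Symmetric Edge
    Edge⇒~   : Edge ⇒ _~_
    unique   : ∀ {u v w} → Edge u v → Edge u w → v ≡ w

  Covered : Pred (V G) 0ℓ
  Covered v = ∃[ w ] Edge v w

-- inj₂ v is the new leaf attached at the covered vertex v.
_∓_ : (G : Graph) → Matching G → Graph
G ∓ M = record
  { V        = W
  ; _~_      = Adj
  ; ~-sym    = λ {x} {y} → Adj-sym x y
  ; ~-irrefl = λ { {x} refl → Adj-irrefl x }
  }
  where
  open Graph G using (_~_; ~-sym; ~-irrefl)
  open Matching M

  W : Set
  W = V G ⊎ [ v ∈ V G ∣ Covered v ]

  Adj : Rel W 0ℓ
  Adj (inj₁ u) (inj₁ v) = u ~ v × ¬ Edge u v
  Adj (inj₁ u) (inj₂ v) = u ≡ value v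
  Adj (inj₂ u) (inj₁ v) = v ≡ value u
  Adj (inj₂ _) (inj₂ _) = ⊥

  Adj-sym : ∀ x y → Adj x y → Adj y x
  Adj-sym (inj₁ _) (inj₁ _) (e , ∉M) = ~-sym e , λ e′ → ∉M (Edge-sym e′)
  Adj-sym (inj₁ _) (inj₂ _) p        = p
  Adj-sym (inj₂ _) (inj₁ _) p        = p

  Adj-irrefl : ∀ x → ¬ Adj x x
  Adj-irrefl (inj₁ _) (e , _) = ~-irrefl refl e

data Status : Set where
  A B : Status

record LabeledGraph : Set₁ where
  field
    graph  : Graph
    status : V graph → Status

open LabeledGraph using (graph; status)

path : ℕ → Graph
path n = record
  { V        = Fin n
  ; _~_      = SymClosure Next
  ; ~-sym    = symmetric Next
  ; ~-irrefl = λ { refl (fwd p) → 1+n≢n p ; refl (bwd p) → 1+n≢n p }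
  }
  where
  Next : Rel (Fin n) 0ℓ
  Next i j = suc (toℕ i) ≡ toℕ j

labeledPath : ∀ {n} → Vec Status n → LabeledGraph
labeledPath {n} s = record { graph = path n ; status = lookup s }

-- The disjoint union of G and H together with the edge xy.
joinByEdge : (G : Graph) → V G → (H : Graph) → V H → Graph
joinByEdge G x H y = record
  { V        = V G ⊎ V H
  ; _~_      = Adj
  ; ~-sym    = λ {u} {v} → Adj-sym u v
  ; ~-irrefl = λ { {u} refl → Adj-irrefl u }
  }
  where
  module G = Graph G
  module H = Graph H

  Adj : Rel (V G ⊎ V H) 0ℓ
  Adj (inj₁ u) (inj₁ v) = u G.~ v
  Adj (inj₁ u) (inj₂ v) = u ≡ x × v ≡ y
  Adj (inj₂ u) (inj₁ v) = v ≡ x × u ≡ y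
  Adj (inj₂ u) (inj₂ v) = u H.~ v

  Adj-sym : ∀ u v → Adj u v → Adj v u
  Adj-sym (inj₁ _) (inj₁ _) p = G.~-sym p
  Adj-sym (inj₁ _) (inj₂ _) p = p
  Adj-sym (inj₂ _) (inj₁ _) p = p
  Adj-sym (inj₂ _) (inj₂ _) p = H.~-sym p

  Adj-irrefl : ∀ u → ¬ Adj u u
  Adj-irrefl (inj₁ _) = G.~-irrefl refl
  Adj-irrefl (inj₂ _) = H.~-irrefl refl

joinLabeled : (L : LabeledGraph) → V (graph L) →
              (K : LabeledGraph) → V (graph K) → LabeledGraph
joinLabeled L x K y = record
  { graph  = joinByEdge (graph L) x (graph K) y
  ; status = [ status L , status K ]
  }

data Labeled-𝒪 : LabeledGraph → Set₁ where
  P₆ : Labeled-𝒪 (labeledPath (B ∷ B ∷ A ∷ A ∷ B ∷ B ∷ []))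

  -- The path xyz has x ≢ z because the statuses of x and z differ.
  -- The new edge za ends at the first vertex a of the new path abc.
  𝒪₁ : ∀ {L} (let open Graph (graph L) using (_~_)) → Labeled-𝒪 L →
       ∀ {x y z} → x ~ y → y ~ z →
       status L x ≡ B → status L y ≡ B → status L z ≡ A →
       Labeled-𝒪 (joinLabeled L z (labeledPath (A ∷ B ∷ B ∷ [])) 0F)

  -- The new edge dx ends at the last vertex d of the new path abcd.
  𝒪₂ : ∀ {L} (let open Graph (graph L) using (_~_)) → Labeled-𝒪 L →
       ∀ {x y} → x ~ y →
       status L x ≡ B → status L y ≡ B →
       Labeled-𝒪 (joinLabeled L x (labeledPath (B ∷ B ∷ A ∷ A ∷ [])) 3F)

_∈𝒪 : Graph → Set₁
T ∈𝒪 = Σ[ L ∈ LabeledGraph ] (Labeled-𝒪 L × T ≅ graph L)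

-- A partition of the set N into finitely many nonempty blocks, listed
-- without repetition: blocks with different indices are disjoint and
-- nonempty, hence different.
record Partition {X : Set} (N : Pred X 0ℓ) : Set₁ where
  field
    size     : ℕ
    block    : Fin size → Pred X 0ℓ
    nonempty : ∀ i → Satisfiable (block i)
    disjoint : ∀ {i j u} → block i u → block j u → i ≡ j
    union    : ∀ {u} → N u ⇔ (∃[ i ] block i u)

NeighborhoodPartitions : Graph → Set₁
NeighborhoodPartitions G = ∀ (v : V G) → Partition (v ~_)
  where open Graph G using (_~_)

module _ (G : Graph) (𝒫 : NeighborhoodPartitions G) where
  open Graph G using (_~_; ~-irrefl)
  private module 𝒫 v = Partition (𝒫 v)

  -- original v, pendant v and block v i stand for v, (v,1) and (v,A), where A
  -- is the i-th block of 𝒫(v).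
  data SubdivisionVertex : Set where
    original : V G → SubdivisionVertex
    pendant  : V G → SubdivisionVertex
    block    : (v : V G) → Fin (𝒫.size v) → SubdivisionVertex

  data SubdivisionEdge : Rel SubdivisionVertex 0ℓ where
    E₁ : ∀ v → SubdivisionEdge (original v) (pendant v)
    E₂ : ∀ v i → SubdivisionEdge (original v) (block v i)
    E₃ : ∀ {u v i j} → u ~ v → 𝒫.block u i v → 𝒫.block v j u →
         SubdivisionEdge (block u i) (block v j)

  2-subdivision : Graph
  2-subdivision = record
    { V        = SubdivisionVertex
    ; _~_      = SymClosure SubdivisionEdge
    ; ~-sym    = symmetric SubdivisionEdge
    ; ~-irrefl = λ { refl (fwd (E₃ e _ _)) → ~-irrefl refl e
                   ; refl (bwd (E₃ e _ _)) → ~-irrefl refl e }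
    }

_∈𝒪′ : Graph → Set₁
T ∈𝒪′ = IsTree T ×
  (Σ[ R ∈ Graph ] Σ[ fin ∈ Finite R ] Σ[ 𝒫 ∈ NeighborhoodPartitions R ]
    (IsTree R × 2 ≤ Finite.order fin × T ≅ 2-subdivision R 𝒫))

{-# OPTIONS --safe #-}

-- Both sides say that T has a labelling by A and B in which every vertex has
-- exactly one neighbour of status B (its mate), every A-vertex has a
-- neighbour of status A, and some vertex has status A.
--
-- The labelled trees of 𝒪 have these properties by induction.  Conversely, an
-- induced P₆ around an edge between two A-vertices is in 𝒪, and as long as an
-- induced copy of a member of 𝒪 misses a vertex, some edge uw of T leaves it;
-- then w has status A, and 𝒪₁ or 𝒪₂, according to the status of u, enlarges
-- the copy.  Every edge of T being a bridge, no second edge joins the added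
-- path to the copy, which therefore stays induced.
--
-- In a 2-subdivision, giving status A to the blocks is such a labelling, and
-- the B-vertices are exactly the leaves and their neighbours; hence the
-- labellings of the components of T ∓ M fit together to one of T.  Conversely,
-- given a labelling, let M consist of the BB-edges both of whose ends have an
-- A-neighbour.  In each component of T ∓ M the B-vertices with an A-neighbour
-- are the vertices of R, and their A-neighbours are the blocks.  A tree in 𝒪′
-- itself need not be treated separately, as M may be empty.

module Submission where

open import Defs
open import Data.Empty using (⊥; ⊥-elim; ⊥-elim-irr)
open import Data.Fin.Base using (Fin; zero; suc; toℕ; fromℕ; inject₁)
open import Data.Fin.Patterns using (0F; 1F; 2F; 3F; 4F; 5F)
open import Data.Fin.Properties using (any?; injective⇒≤; suc-injective; +↔⊎; toℕ-injective; toℕ-inject₁)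
  renaming (_≟_ to _≟ᶠ_)
open import Data.Irrelevant using (Irrelevant) renaming ([_] to irr)
open import Data.Nat.Base using (ℕ; zero; suc; _+_; _≤_; _<_; z≤n; s≤s)
import Data.Nat.Properties as ℕ
open import Data.Product.Base using (Σ-syntax; ∃-syntax; ∃₂; _×_; _,_; proj₁; proj₂)
open import Data.Refinement using (Refinement; Refinement-syntax; _,_; value; value-injective)
open import Data.Sum.Base using (_⊎_; inj₁; inj₂; [_,_])
open import Data.Sum.Function.Propositional using (_⊎-↔_)
open import Data.Sum.Properties using (inj₁-injective; inj₂-injective)
open import Data.Vec.Base using (Vec; []; _∷_; lookup)
open import Data.Vec.Functional using () renaming (_∷_ to _∷ᶠ_)
open import Function.Base using (_∘_; id)
open import Function.Bundles using (_↔_; _⇔_; module Inverse; module Injection; module Equivalence; mk↔ₛ′; mk⇔)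
open import Function.Definitions using (Injective)
open import Function.Properties.Inverse using (↔-trans; ↔-sym; ↔-refl; ↔⇒↣)
open import Level using (0ℓ)
open import Relation.Binary.Construct.Closure.ReflexiveTransitive as Star using (Star; ε; _◅_; _◅◅_)
open import Relation.Binary.Construct.Closure.Symmetric using (fwd; bwd)
open import Relation.Binary.Core using (Rel; _⇒_)
open import Relation.Binary.Definitions using (Symmetric; Decidable; DecidableEquality)
open import Relation.Binary.PropositionalEquality using (_≡_; _≢_; refl; sym; trans; cong; subst; subst₂)
open import Relation.Nullary.Decidable
  using (Dec; yes; no; map′; _×-dec_; _⊎-dec_; recompute; ¬?; decidable-stable)
open import Relation.Nullary.Negation using (¬_; contradiction)
open import Relation.Unary using (Pred) renaming (Decidable to Decidable₁)

open Graph using (V)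
open LabeledGraph using (graph; status)

-- Deciding and counting in finite types

satisfies : ∀ {X : Set} {P : Pred X 0ℓ} → Decidable₁ P → (x : Refinement X P) → P (value x)
-- The membership proof in a refinement is irrelevant; deciding `P` again yields one that can be
-- used in proofs.
satisfies P? (x , irr p) = recompute (P? x) p

module _ {X : Set} {n : ℕ} (X↔n : X ↔ Fin n) where
  open Inverse X↔n
  open Injection (↔⇒↣ X↔n) using () renaming (injective to to-injective)

  search : {P : Pred X 0ℓ} → Decidable₁ P → Dec (∃[ x ] P x)
  search {P} P? = map′ (λ (i , p) → from i , p)
                       (λ (x , p) → to x , subst P (sym (strictlyInverseʳ x)) p)
                       (any? (P? ∘ from))

  decEq : DecidableEquality X
  decEq x y = map′ to-injective (cong to) (to x ≟ᶠ to y)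

  injection⇒≤ : ∀ {k} {f : Fin k → X} → Injective _≡_ _≡_ f → k ≤ n
  injection⇒≤ f-inj = injective⇒≤ (f-inj ∘ to-injective)

  distinct⇒2≤ : ∀ {x y : X} → x ≢ y → 2 ≤ n
  distinct⇒2≤ {x} {y} x≢y = injection⇒≤ {f = f} f-inj
    where
    f : Fin 2 → X
    f zero    = x
    f (suc _) = y
    f-inj : Injective _≡_ _≡_ f
    f-inj {zero}     {zero}     _  = refl
    f-inj {zero}     {suc _}    eq = contradiction eq x≢y
    f-inj {suc _}    {zero}     eq = contradiction (sym eq) x≢y
    f-inj {suc zero} {suc zero} _  = refl

enumerateFin : ∀ {n} {P : Pred (Fin n) 0ℓ} → Decidable₁ P → ∃[ k ] ([ i ∈ Fin n ∣ P i ] ↔ Fin k)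
enumerateFin {zero} P? = 0 , mk↔ₛ′ (λ ()) (λ ()) (λ ()) (λ ())
enumerateFin {suc n} {P} P? with enumerateFin (P? ∘ suc) | P? zero
... | k , rest | yes p = suc k , mk↔ₛ′ f g f∘g g∘f
  where
  open Inverse rest
  f : [ i ∈ Fin (suc n) ∣ P i ] → Fin (suc k)
  f (zero , _)  = zero
  f (suc i , q) = suc (to (i , q))
  g : Fin (suc k) → [ i ∈ Fin (suc n) ∣ P i ]
  g zero    = zero , irr p
  g (suc j) = let i , q = from j in suc i , q
  f∘g : ∀ j → f (g j) ≡ j
  f∘g zero    = refl
  f∘g (suc j) = cong suc (strictlyInverseˡ j)
  g∘f : ∀ i → g (f i) ≡ i
  g∘f (zero , _)  = refl
  g∘f (suc i , q) = value-injective (cong (suc ∘ value) (strictlyInverseʳ (i , q)))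
... | k , rest | no ¬p = k , mk↔ₛ′ f g f∘g g∘f
  where
  open Inverse rest
  f : [ i ∈ Fin (suc n) ∣ P i ] → Fin k
  f (zero , irr q) = ⊥-elim-irr (¬p q)
  f (suc i , q) = to (i , q)
  g : Fin k → [ i ∈ Fin (suc n) ∣ P i ]
  g j = let i , q = from j in suc i , q
  f∘g : ∀ j → f (g j) ≡ j
  f∘g = strictlyInverseˡ
  g∘f : ∀ i → g (f i) ≡ i
  g∘f (zero , irr q) = contradiction (satisfies P? (zero , irr q)) ¬p
  g∘f (suc i , q) = value-injective (cong (suc ∘ value) (strictlyInverseʳ (i , q)))

enumerate : ∀ {X : Set} {n} → X ↔ Fin n → {P : Pred X 0ℓ} → Decidable₁ P → ∃[ k ] ([ x ∈ X ∣ P x ] ↔ Fin k)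
enumerate {X} X↔n {P} P? = let k , P↔k = enumerateFin (P? ∘ from) in k , ↔-trans (mk↔ₛ′ f g f∘g g∘f) P↔k
  where
  open Inverse X↔n
  f : [ x ∈ X ∣ P x ] → [ i ∈ Fin _ ∣ P (from i) ]
  f (x , irr p) = to x , irr (subst P (sym (strictlyInverseʳ x)) p)
  g : [ i ∈ Fin _ ∣ P (from i) ] → [ x ∈ X ∣ P x ]
  g (i , p) = from i , p
  f∘g : ∀ i → f (g i) ≡ i
  f∘g (i , _) = value-injective (strictlyInverseˡ i)
  g∘f : ∀ x → g (f x) ≡ x
  g∘f (x , _) = value-injective (strictlyInverseʳ x)

-- Walks

along : ∀ {X : Set} {R : Rel X 0ℓ} {n} (x : Fin (suc n) → X) →
        (∀ i → R (x (inject₁ i)) (x (suc i))) → ∀ i → Star R (x zero) (x i)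
along             x steps zero    = ε
along {n = suc _} x steps (suc i) = steps zero ◅ along (x ∘ suc) (steps ∘ suc) i

module _ {X : Set} (R : Rel X 0ℓ) where

  record SimplePath (u v : X) : Set where
    field
      length    : ℕ
      vertex    : Fin (suc length) → X
      injective : Injective _≡_ _≡_ vertex
      step      : ∀ i → R (vertex (inject₁ i)) (vertex (suc i))
      start     : vertex zero ≡ u
      end       : vertex (fromℕ length) ≡ v

module _ {X : Set} {R : Rel X 0ℓ} where

  suffix : ∀ {m} (x : Fin (suc m) → X) → Injective _≡_ _≡_ x →
           (∀ i → R (x (inject₁ i)) (x (suc i))) →
           ∀ i → SimplePath R (x i) (x (fromℕ m))
  suffix x x-inj steps zero = record
    { length = _ ; vertex = x ; injective = x-inj ; step = steps ; start = refl ; end = refl }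
  suffix {suc m} x x-inj steps (suc i) = suffix (x ∘ suc) (suc-injective ∘ x-inj) (steps ∘ suc) i

  -- If the first vertex occurs again in the simplified rest, the loop is cut by keeping only the
  -- suffix from that occurrence.
  simplify : DecidableEquality X → ∀ {u v} → Star R u v → SimplePath R u v
  simplify _≟_ {u} ε = record
    { length = 0 ; vertex = λ _ → u ; injective = λ { {zero} {zero} _ → refl }
    ; step = λ () ; start = refl ; end = refl }
  simplify _≟_ {u} (_◅_ {j = u′} r rs) with simplify _≟_ rs
  ... | p with any? (λ i → SimplePath.vertex p i ≟ u)
  ...   | yes (i , refl) = subst (SimplePath R u) end (suffix vertex injective step i)
    where open SimplePath p
  ...   | no u∉p = record
    { length = suc length ; vertex = u ∷ᶠ vertex ; injective = inj
    ; step = λ { zero → subst (R u) (sym start) r ; (suc i) → step i }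
    ; start = refl ; end = end }
    where
    open SimplePath p
    inj : Injective _≡_ _≡_ (u ∷ᶠ vertex)
    inj {zero}  {zero}  _  = refl
    inj {zero}  {suc j} eq = contradiction (j , sym eq) u∉p
    inj {suc i} {zero}  eq = contradiction (i , eq) u∉p
    inj {suc i} {suc j} eq = cong suc (injective eq)

  module _ {n} (X↔n : X ↔ Fin n) (R? : Decidable R) where

    private
      Within : ℕ → Rel X 0ℓ
      Within zero    u v = u ≡ v
      Within (suc k) u v = u ≡ v ⊎ ∃[ w ] (R u w × Within k w v)

      within? : ∀ k → Decidable (Within k)
      within? zero    u v = decEq X↔n u v
      within? (suc k) u v = decEq X↔n u v ⊎-dec search X↔n (λ w → R? u w ×-dec within? k w v)

      within⇒star : ∀ k → Within k ⇒ Star R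
      within⇒star zero    refl               = ε
      within⇒star (suc k) (inj₁ refl)        = ε
      within⇒star (suc k) (inj₂ (_ , r , w)) = r ◅ within⇒star k w

      path⇒within : ∀ {m k} → m ≤ k → (x : Fin (suc m) → X) →
                    (∀ i → R (x (inject₁ i)) (x (suc i))) → Within k (x zero) (x (fromℕ m))
      path⇒within {zero}  {zero}  _         x steps = refl
      path⇒within {zero}  {suc _} _         x steps = inj₁ refl
      path⇒within {suc _} {suc _} (s≤s m≤k) x steps =
        inj₂ (_ , steps zero , path⇒within m≤k (x ∘ suc) (steps ∘ suc))

    -- A simple path has at most `n` vertices, so searching walks of at most `n` steps misses
    -- nothing.
    star? : Decidable (Star R)
    star? u v = map′ (within⇒star n) shorten (within? n u v)
      where
      shorten : Star R u v → Within n u v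
      shorten rs with simplify (decEq X↔n) rs
      ... | record { vertex = x ; injective = inj ; step = steps ; start = refl ; end = refl } =
        path⇒within (ℕ.≤-trans (ℕ.n≤1+n _) (injection⇒≤ X↔n inj)) x steps

-- Acyclicity: every edge is a bridge

module _ (G : Graph) where
  open Graph G using (_~_)

  Without : (a b : V G) → Rel (V G) 0ℓ
  Without a b u v = u ~ v × ¬ (u ≡ a × v ≡ b) × ¬ (u ≡ b × v ≡ a)

  -- Acyclicity in the form used from here on: a contradiction needs only some walk round an edge,
  -- not a cycle with distinct vertices.
  EveryEdgeBridge : Set
  EveryEdgeBridge = ∀ {a b} → a ~ b → ¬ Star (Without a b) a b

module _ {G : Graph} where
  open Graph G using (_~_; ~-sym; ~-irrefl)

  without-reverse : ∀ {a b u v} → Star (Without G a b) u v → Star (Without G a b) v u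
  without-reverse = Star.reverse λ (e , p , q) →
    ~-sym e , (λ (x , y) → q (y , x)) , (λ (x , y) → p (y , x))

  without-swap : ∀ {a b u v} → Star (Without G a b) u v → Star (Without G b a) u v
  without-swap = Star.map λ (e , p , q) → e , q , p

  -- A walk round ab contains a simple path. Length 0 makes ab a loop, length 1 makes the path the
  -- excluded edge, and a longer path is closed by ab to a cycle.
  acyclic⇒bridges : DecidableEquality (V G) → ¬ Cycle G → EveryEdgeBridge G
  acyclic⇒bridges _≟_ acyclic {a} {b} a~b walk with simplify _≟_ walk
  ... | record { length = 0 ; start = refl ; end = refl } = ~-irrefl refl a~b
  ... | record { length = 1 ; step = step ; start = refl ; end = refl } =
    proj₁ (proj₂ (step zero)) (refl , refl)
  ... | record { length = suc (suc m) ; vertex = vertex ; injective = injective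
               ; step = step ; start = refl ; end = refl } =
    acyclic record { m = suc (suc m) ; 2≤m = s≤s (s≤s z≤n) ; vertex = vertex
                   ; injective = injective ; step = proj₁ ∘ step ; close = ~-sym a~b }

  -- The steps of a cycle form a walk round its closing edge.
  bridges⇒acyclic : EveryEdgeBridge G → ¬ Cycle G
  bridges⇒acyclic bridges c = bridges (~-sym close) (along vertex steps (fromℕ m))
    where
    open Cycle c
    steps : ∀ i → Without G (vertex zero) (vertex (fromℕ m)) (vertex (inject₁ i)) (vertex (suc i))
    steps i = step i
      , (λ (p , q) → long i 2≤m (injective p) (injective q))
      , (λ (p , q) → contradiction (injective q) λ ())
      where
      -- The first step could end at the last vertex only if `m` were 1.
      long : ∀ {m} (i : Fin m) → 2 ≤ m → inject₁ i ≡ zero → suc i ≢ fromℕ m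
      long {suc (suc _)} zero (s≤s (s≤s _)) _ ()

A≢B : A ≢ B
A≢B ()

_≟ₛ_ : DecidableEquality Status
A ≟ₛ A = yes refl
A ≟ₛ B = no λ ()
B ≟ₛ A = no λ ()
B ≟ₛ B = yes refl

≢B⇒A : ∀ {s} → s ≢ B → s ≡ A
≢B⇒A {A} _ = refl
≢B⇒A {B} s≢B = contradiction refl s≢B

≢A⇒B : ∀ {s} → s ≢ A → s ≡ B
≢A⇒B {A} s≢A = contradiction refl s≢A
≢A⇒B {B} _ = refl

-- Labellings

record Labeling (G : Graph) (st : V G → Status) : Set where
  open Graph G using (_~_)
  field
    mate        : V G → V G
    mate-~      : ∀ v → v ~ mate v
    mate-B      : ∀ v → st (mate v) ≡ B
    mate-unique : ∀ {v w} → v ~ w → st w ≡ B → w ≡ mate v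
    A-neighbour : ∀ {v} → st v ≡ A → ∃[ w ] (v ~ w × st w ≡ A)
    A-vertex    : ∃[ v ] st v ≡ A

  mate-cong : ∀ {u v w} → u ~ v → u ~ w → st v ≡ B → st w ≡ B → v ≡ w
  mate-cong u~v u~w vB wB = trans (mate-unique u~v vB) (sym (mate-unique u~w wB))

  mate-involutive : ∀ {v} → st v ≡ B → mate (mate v) ≡ v
  mate-involutive {v} vB = sym (mate-unique (Graph.~-sym G (mate-~ v)) vB)

module _ {G H : Graph} (iso : G ≅ H) where
  open _≅_ iso
  open Inverse bijection using () renaming (strictlyInverseˡ to to-from; strictlyInverseʳ to from-to)
  private
    module G = Graph G
    module H = Graph H

  ~-pull : ∀ {v w} → to v H.~ w → v G.~ from w
  ~-pull {v} {w} e = Equivalence.from ~-iff (subst (to v H.~_) (sym (to-from w)) e)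

  labeling-≅ : ∀ {st} → Labeling H st → Labeling G (st ∘ to)
  labeling-≅ {st} lab = record
    { mate        = λ v → from (mate (to v))
    ; mate-~      = λ v → ~-pull (mate-~ (to v))
    ; mate-B      = λ v → trans (cong st (to-from _)) (mate-B (to v))
    ; mate-unique = λ {v} {w} v~w wB →
        trans (sym (from-to w)) (cong from (mate-unique (Equivalence.to ~-iff v~w) wB))
    ; A-neighbour = λ vA → let w , v~w , wA = A-neighbour vA in
        from w , ~-pull v~w , trans (cong st (to-from w)) wA
    ; A-vertex    = let v , vA = A-vertex in from v , trans (cong st (to-from v)) vA
    }
    where open Labeling lab

-- Labellings of the trees in 𝒪

module _ {G : Graph} {x : V G} {H : Graph} {y : V H} where
  private module G = Graph G
  private module H = Graph H

  joinByEdge-connected : Connected G → Connected H → Connected (joinByEdge G x H y)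
  joinByEdge-connected cG cH = record
    { nonempty  = inj₁ x
    ; reachable = λ u v → Star.reverse (λ {i} {j} → J.~-sym {i} {j}) (fromRoot u) ◅◅ fromRoot v
    }
    where
    module J = Graph (joinByEdge G x H y)
    fromRoot : ∀ u → Star J._~_ (inj₁ x) u
    fromRoot (inj₁ u) = Star.gmap inj₁ id (Connected.reachable cG x u)
    fromRoot (inj₂ v) = (refl , refl) ◅ Star.gmap inj₂ id (Connected.reachable cH y v)

path-step : ∀ {n} (i : Fin n) → Graph._~_ (path (suc n)) (inject₁ i) (suc i)
path-step zero    = fwd refl
path-step (suc i) with path-step i
... | fwd p = fwd (cong suc p)
... | bwd p = bwd (cong suc p)

path-connected : ∀ {n} → Connected (path (suc n))
path-connected {n} = record
  { nonempty  = zero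
  ; reachable = λ i j → Star.reverse (Graph.~-sym (path (suc n))) (along id path-step i) ◅◅ along id path-step j
  }

𝒪-connected : ∀ {L} → Labeled-𝒪 L → Connected (graph L)
𝒪-connected P₆ = path-connected
𝒪-connected (𝒪₁ l _ _ _ _ _) = joinByEdge-connected (𝒪-connected l) path-connected
𝒪-connected (𝒪₂ l _ _ _)     = joinByEdge-connected (𝒪-connected l) path-connected

-- The new end of the added edge has status A, so no old vertex gets a second B-neighbour. In 𝒪₁ the
-- new A-vertex a has z as A-neighbour; in 𝒪₂ the vertices c and d are A-neighbours of each other
-- and x is the mate of d.
𝒪-labeling : ∀ {L} → Labeled-𝒪 L → Labeling (graph L) (status L)
𝒪-labeling P₆ = record
  { mate        = lookup (1F ∷ 0F ∷ 1F ∷ 4F ∷ 5F ∷ 4F ∷ [])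
  ; mate-~      = λ { 0F → fwd refl ; 1F → bwd refl ; 2F → bwd refl
                    ; 3F → fwd refl ; 4F → fwd refl ; 5F → bwd refl }
  ; mate-B      = λ { 0F → refl ; 1F → refl ; 2F → refl ; 3F → refl ; 4F → refl ; 5F → refl }
  ; mate-unique = λ
    { {0F} {1F} (fwd refl) _ → refl
    ; {3F} {4F} (fwd refl) _ → refl
    ; {4F} {5F} (fwd refl) _ → refl
    ; {1F} {0F} (bwd refl) _ → refl
    ; {2F} {1F} (bwd refl) _ → refl
    ; {5F} {4F} (bwd refl) _ → refl
    ; {1F} {2F} (fwd refl) ()
    ; {2F} {3F} (fwd refl) ()
    ; {3F} {2F} (bwd refl) ()
    ; {4F} {3F} (bwd refl) ()
    -- Nothing follows the last vertex, but the equation is visibly absurd only once the other end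
    -- is known.
    ; {5F} {0F} (fwd ()) _
    ; {5F} {1F} (fwd ()) _
    ; {5F} {2F} (fwd ()) _
    ; {5F} {3F} (fwd ()) _
    ; {5F} {4F} (fwd ()) _
    ; {5F} {5F} (fwd ()) _
    }
  ; A-neighbour = λ
    { {0F} () ; {1F} () ; {2F} _ → 3F , fwd refl , refl ; {3F} _ → 2F , bwd refl , refl ; {4F} () ; {5F} () }
  ; A-vertex    = 2F , refl
  }
𝒪-labeling (𝒪₁ {L} l {z = z} x~y y~z xB yB zA) = record
  { mate        = [ inj₁ ∘ mate , inj₂ ∘ lookup (1F ∷ 2F ∷ 1F ∷ []) ]
  ; mate-~      = λ { (inj₁ v) → mate-~ v ; (inj₂ 0F) → fwd refl ; (inj₂ 1F) → fwd refl ; (inj₂ 2F) → bwd refl }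
  ; mate-B      = λ { (inj₁ v) → mate-B v ; (inj₂ 0F) → refl ; (inj₂ 1F) → refl ; (inj₂ 2F) → refl }
  ; mate-unique = λ
    { {inj₁ v}  {inj₁ w}  v~w wB        → cong inj₁ (mate-unique v~w wB)
    ; {inj₁ v}  {inj₂ 0F} _ ()
    ; {inj₂ 0F} {inj₁ w}  (refl , _) wB → contradiction (trans (sym zA) wB) A≢B
    ; {inj₂ 0F} {inj₂ 1F} (fwd refl) _  → refl
    ; {inj₂ 1F} {inj₂ 2F} (fwd refl) _  → refl
    ; {inj₂ 2F} {inj₂ 1F} (bwd refl) _  → refl
    ; {inj₂ 1F} {inj₂ 0F} (bwd refl) ()
    ; {inj₂ 2F} {inj₂ 0F} (fwd ()) _
    ; {inj₂ 2F} {inj₂ 1F} (fwd ()) _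
    ; {inj₂ 2F} {inj₂ 2F} (fwd ()) _
    }
  ; A-neighbour = λ
    { {inj₁ v}  vA → let w , v~w , wA = A-neighbour vA in inj₁ w , v~w , wA
    ; {inj₂ 0F} _  → inj₁ z , (refl , refl) , zA
    ; {inj₂ 1F} ()
    ; {inj₂ 2F} ()
    }
  ; A-vertex    = inj₂ 0F , refl
  }
  where open Labeling (𝒪-labeling l)
𝒪-labeling (𝒪₂ {L} l {x = x} x~y xB yB) = record
  { mate        = [ inj₁ ∘ mate , lookup (inj₂ 1F ∷ inj₂ 0F ∷ inj₂ 1F ∷ inj₁ x ∷ []) ]
  ; mate-~      = λ { (inj₁ v) → mate-~ v ; (inj₂ 0F) → fwd refl ; (inj₂ 1F) → bwd refl ; (inj₂ 2F) → bwd refl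
                    ; (inj₂ 3F) → refl , refl }
  ; mate-B      = λ { (inj₁ v) → mate-B v ; (inj₂ 0F) → refl ; (inj₂ 1F) → refl ; (inj₂ 2F) → refl
                    ; (inj₂ 3F) → xB }
  ; mate-unique = λ
    { {inj₁ v}  {inj₁ w}  v~w wB         → cong inj₁ (mate-unique v~w wB)
    ; {inj₁ v}  {inj₂ 3F} _ ()
    ; {inj₂ 3F} {inj₁ w}  (refl , _) _   → refl
    ; {inj₂ 0F} {inj₂ 1F} (fwd refl) _   → refl
    ; {inj₂ 1F} {inj₂ 0F} (bwd refl) _   → refl
    ; {inj₂ 2F} {inj₂ 1F} (bwd refl) _   → refl
    ; {inj₂ 1F} {inj₂ 2F} (fwd refl) ()
    ; {inj₂ 2F} {inj₂ 3F} (fwd refl) ()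
    ; {inj₂ 3F} {inj₂ 2F} (bwd refl) ()
    ; {inj₂ 3F} {inj₂ 0F} (fwd ()) _
    ; {inj₂ 3F} {inj₂ 1F} (fwd ()) _
    ; {inj₂ 3F} {inj₂ 2F} (fwd ()) _
    ; {inj₂ 3F} {inj₂ 3F} (fwd ()) _
    }
  ; A-neighbour = λ
    { {inj₁ v}  vA → let w , v~w , wA = A-neighbour vA in inj₁ w , v~w , wA
    ; {inj₂ 2F} _  → inj₂ 3F , fwd refl , refl
    ; {inj₂ 3F} _  → inj₂ 2F , bwd refl , refl
    ; {inj₂ 0F} ()
    ; {inj₂ 1F} ()
    }
  ; A-vertex    = inj₂ 2F , refl
  }
  where open Labeling (𝒪-labeling l)

-- Embeddings

record IsEmbedding (G H : Graph) (f : V G → V H) : Set where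
  private
    module G = Graph G
    module H = Graph H
  field
    injective : Injective _≡_ _≡_ f
    ~-to      : ∀ {u v} → u G.~ v → f u H.~ f v
    ~-from    : ∀ {u v} → f u H.~ f v → u G.~ v

embedding⇒≅ : ∀ {G H f} → IsEmbedding G H f → (∀ v → ∃[ u ] f u ≡ v) → H ≅ G
embedding⇒≅ {G} {H} {f} emb surj = record
  { bijection = mk↔ₛ′ f⁻¹ f (λ u → injective (f-f⁻¹ (f u))) f-f⁻¹
  ; ~-iff     = λ {u} {v} → mk⇔
      (λ e → ~-from (subst₂ H._~_ (sym (f-f⁻¹ u)) (sym (f-f⁻¹ v)) e))
      (λ e → subst₂ H._~_ (f-f⁻¹ u) (f-f⁻¹ v) (~-to e))
  }
  where
  open IsEmbedding emb
  module H = Graph H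
  f⁻¹ : V H → V G
  f⁻¹ v = proj₁ (surj v)
  f-f⁻¹ : ∀ v → f (f⁻¹ v) ≡ v
  f-f⁻¹ v = proj₂ (surj v)

module _ {T : Graph} (_≟_ : DecidableEquality (V T)) (bridges : EveryEdgeBridge T) where
  open Graph T using (_~_; ~-sym; ~-irrefl)

  -- By induction the tail is an induced path. If the first vertex recurred in it, or were adjacent
  -- to a vertex beyond the second, the tail would lead round the first edge.
  nonbacktracking⇒embedding :
    ∀ {n} (x : Fin (suc n) → V T) → (∀ i → x (inject₁ i) ~ x (suc i)) →
    (∀ {i j} → suc (suc (toℕ i)) ≡ toℕ j → x i ≢ x j) → IsEmbedding (path (suc n)) T x
  nonbacktracking⇒embedding {zero} x step turn = record
    { injective = λ { {zero} {zero} _ → refl }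
    ; ~-to      = λ { {zero} {zero} (fwd ()) ; {zero} {zero} (bwd ()) }
    ; ~-from    = λ { {zero} {zero} e → ⊥-elim (~-irrefl refl e) }
    }
  nonbacktracking⇒embedding {suc n} x step turn = record
    { injective = inj ; ~-to = to ; ~-from = from }
    where
    open IsEmbedding (nonbacktracking⇒embedding (x ∘ suc) (step ∘ suc) (turn ∘ cong suc)) using ()
      renaming (injective to tail-inj; ~-to to tail-to; ~-from to tail-from)
    -- The tail avoids the first edge: its first step could return to `x 0F`, which `turn` forbids,
    -- and elsewhere injectivity of the tail applies.
    walk : ∀ i → Star (Without T (x 1F) (x 0F)) (x 1F) (x (suc i))
    walk = along (x ∘ suc) λ i → step (suc i) , avoid i , λ (_ , p) → contradiction (tail-inj p) λ ()
      where
      avoid : ∀ i → ¬ (x (suc (inject₁ i)) ≡ x 1F × x (suc (suc i)) ≡ x 0F)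
      avoid zero    (_ , p) = turn refl (sym p)
      avoid (suc i) (p , _) = contradiction (tail-inj p) λ ()
    x₀≢ : ∀ i → x 0F ≢ x (suc i)
    x₀≢ i p = bridges (~-sym (step zero)) (subst (Star _ _) (sym p) (walk i))
    x₀≁ : ∀ i → ¬ x 0F ~ x (suc (suc i))
    x₀≁ i e = bridges (~-sym (step zero)) (walk (suc i) ◅◅
      (~-sym e , (λ (p , _) → contradiction (tail-inj p) λ ()) , (λ (p , _) → x₀≢ (suc i) (sym p))) ◅ ε)
    inj : Injective _≡_ _≡_ x
    inj {zero}  {zero}  _ = refl
    inj {zero}  {suc j} p = contradiction p (x₀≢ j)
    inj {suc i} {zero}  p = contradiction (sym p) (x₀≢ i)
    inj {suc i} {suc j} p = cong suc (tail-inj p)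
    to : ∀ {i j} → Graph._~_ (path (suc (suc n))) i j → x i ~ x j
    to {zero}  {suc zero}    (fwd _) = step zero
    to {suc zero} {zero}     (bwd _) = ~-sym (step zero)
    to {suc i} {suc j}       (fwd p) = tail-to (fwd (ℕ.suc-injective p))
    to {suc i} {suc j}       (bwd p) = tail-to (bwd (ℕ.suc-injective p))
    to {zero} {zero} (fwd ())
    to {zero} {zero} (bwd ())
    to {zero} {suc (suc _)} (fwd ())
    to {zero} {suc j} (bwd ())
    to {suc i} {zero} (fwd ())
    to {suc (suc _)} {zero} (bwd ())
    from : ∀ {i j} → x i ~ x j → Graph._~_ (path (suc (suc n))) i j
    from {zero}        {zero}        e = ⊥-elim (~-irrefl refl e)
    from {zero}        {suc zero}    e = fwd refl
    from {zero}        {suc (suc j)} e = contradiction e (x₀≁ j)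
    from {suc zero}    {zero}        e = bwd refl
    from {suc (suc i)} {zero}        e = contradiction (~-sym e) (x₀≁ i)
    from {suc i}       {suc j}       e with tail-from e
    ... | fwd p = fwd (cong suc p)
    ... | bwd p = bwd (cong suc p)

  -- Neither copy uses the edge from `f x` to `g y`, as each misses one end of it. A common vertex
  -- or a second edge between the copies would therefore complete a walk round this bridge.
  join-embedding :
    ∀ {G H f g} → IsEmbedding G T f → IsEmbedding H T g → Connected G → Connected H →
    ∀ {x y} → f x ~ g y → (∀ u → f u ≢ g y) → (∀ v → g v ≢ f x) →
    IsEmbedding (joinByEdge G x H y) T [ f , g ]
  join-embedding {G} {H} {f} {g} ef eg cG cH {x} {y} s~w w∉f s∉g = record
    { injective = inj ; ~-to = λ {u} {v} → to u v ; ~-from = λ {u} {v} → from u v }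
    where
    module f = IsEmbedding ef
    module g = IsEmbedding eg
    h : V G ⊎ V H → V T
    h = [ f , g ]
    fWalk : ∀ u → Star (Without T (f x) (g y)) (f x) (f u)
    fWalk u = Star.gmap f (λ {i} {j} e → f.~-to e , (λ (_ , p) → w∉f j p) , (λ (p , _) → w∉f i p))
                              (Connected.reachable cG x u)
    gWalk : ∀ v → Star (Without T (f x) (g y)) (g v) (g y)
    gWalk v = Star.gmap g (λ {i} {j} e → g.~-to e , (λ (p , _) → s∉g i p) , (λ (_ , p) → s∉g j p))
                              (Connected.reachable cH v y)
    ¬another : ∀ u v → ¬ Without T (f x) (g y) (f u) (g v)
    ¬another u v e = bridges s~w (fWalk u ◅◅ e ◅ gWalk v)
    f≢g : ∀ u v → f u ≢ g v
    f≢g u v p = bridges s~w (fWalk u ◅◅ subst (λ z → Star (Without T (f x) (g y)) z (g y)) (sym p) (gWalk v))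
    cross : ∀ u v → f u ~ g v → u ≡ x × v ≡ y
    cross u v e with f u ≟ f x | g v ≟ g y
    ... | yes p | yes q = f.injective p , g.injective q
    ... | no ¬p | _     = contradiction (e , (λ (p , _) → ¬p p) , (λ (p , _) → w∉f u p)) (¬another u v)
    ... | _     | no ¬q = contradiction (e , (λ (_ , q) → ¬q q) , (λ (p , _) → w∉f u p)) (¬another u v)
    inj : Injective _≡_ _≡_ h
    inj {inj₁ _} {inj₁ _} p = cong inj₁ (f.injective p)
    inj {inj₁ u} {inj₂ v} p = contradiction p (f≢g u v)
    inj {inj₂ v} {inj₁ u} p = contradiction (sym p) (f≢g u v)
    inj {inj₂ _} {inj₂ _} p = cong inj₂ (g.injective p)
    to : ∀ u v → Graph._~_ (joinByEdge G x H y) u v → h u ~ h v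
    to (inj₁ _) (inj₁ _) e             = f.~-to e
    to (inj₁ _) (inj₂ _) (refl , refl) = s~w
    to (inj₂ _) (inj₁ _) (refl , refl) = ~-sym s~w
    to (inj₂ _) (inj₂ _) e             = g.~-to e
    from : ∀ u v → h u ~ h v → Graph._~_ (joinByEdge G x H y) u v
    from (inj₁ _) (inj₁ _) e = f.~-from e
    from (inj₁ u) (inj₂ v) e = cross u v e
    from (inj₂ v) (inj₁ u) e = cross u v (~-sym e)
    from (inj₂ _) (inj₂ _) e = g.~-from e

-- From a labelling to 𝒪

module _ {T : Graph} (fin : Finite T) (connected : Connected T) (bridges : EveryEdgeBridge T)
         {st : V T → Status} (labeling : Labeling T st) where

  open Graph T using (_~_; ~-sym)
  open Finite fin using (order; vertices)
  open Labeling labeling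

  private
    _≟_ : DecidableEquality (V T)
    _≟_ = decEq vertices

    -- A trail turns back only at vertices x i, x (i + 2) of equal status.
    trail : ∀ {n} (s : Vec Status (2 + n)) (x : Vec (V T) (2 + n)) →
            (∀ i → st (lookup x i) ≡ lookup s i) →
            (∀ i → lookup x (inject₁ i) ~ lookup x (suc i)) →
            (∀ i → lookup s (inject₁ (inject₁ i)) ≢ lookup s (suc (suc i))) →
            IsEmbedding (path (2 + n)) T (lookup x)
    trail s x label step alternate = nonbacktracking⇒embedding _≟_ bridges (lookup x) step turn
      where
      turn : ∀ {i j} → suc (suc (toℕ i)) ≡ toℕ j → lookup x i ≢ lookup x j
      turn {i} {suc zero} ()
      turn {i} {suc (suc j)} p q = alternate j (trans (cong (lookup s) (toℕ-injective
        (trans (toℕ-inject₁ (inject₁ j)) (trans (toℕ-inject₁ j) (sym (ℕ.suc-injective (ℕ.suc-injective p)))))))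
        (trans (sym (label i)) (trans (cong st q) (label (suc (suc j))))))

    -- An induced copy in `T` of a member of 𝒪 with matching statuses; the number `k` of its
    -- vertices bounds the growth.
    record Partial (k : ℕ) : Set₁ where
      field
        {L}       : LabeledGraph
        member    : Labeled-𝒪 L
        f         : V (graph L) → V T
        embedding : IsEmbedding (graph L) T f
        f-status  : ∀ u → st (f u) ≡ status L u
        size      : V (graph L) ↔ Fin k

      Image : Pred (V T) 0ℓ
      Image v = ∃[ u ] f u ≡ v

      image? : Decidable₁ Image
      image? v = search size (λ u → f u ≟ v)

      module L = Labeling (𝒪-labeling member)

      -- The copy is closed under mates, which is why a vertex just outside it has status A.
      image-mate : ∀ u → f (L.mate u) ≡ mate (f u)
      image-mate u = mate-unique (IsEmbedding.~-to embedding (L.mate-~ u)) (trans (f-status _) (L.mate-B u))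

    seed : Partial 6
    seed = record
      { member    = P₆
      ; f         = lookup x
      ; embedding = trail (B ∷ B ∷ A ∷ A ∷ B ∷ B ∷ []) x label
          (λ { 0F → ~-sym (mate-~ b) ; 1F → ~-sym (mate-~ v) ; 2F → v~w ; 3F → mate-~ w ; 4F → mate-~ b′ })
          (λ { 0F () ; 1F () ; 2F () ; 3F () })
      ; f-status  = label
      ; size      = ↔-refl
      }
      where
      v w b b′ : V T
      v = proj₁ A-vertex
      w = proj₁ (A-neighbour (proj₂ A-vertex))
      b = mate v
      b′ = mate w
      v~w : v ~ w
      v~w = proj₁ (proj₂ (A-neighbour (proj₂ A-vertex)))
      x : Vec (V T) 6
      -- The edge vw is prolonged at both ends by a mate and the mate of that mate; statuses two
      -- places apart differ, so the walk never turns back.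
      x = mate b ∷ b ∷ v ∷ w ∷ b′ ∷ mate b′ ∷ []
      label : ∀ i → st (lookup x i) ≡ lookup (B ∷ B ∷ A ∷ A ∷ B ∷ B ∷ []) i
      label 0F = mate-B b
      label 1F = mate-B v
      label 2F = proj₂ A-vertex
      label 3F = proj₂ (proj₂ (A-neighbour (proj₂ A-vertex)))
      label 4F = mate-B w
      label 5F = mate-B b′

    module _ {k} (P : Partial k) where
      open Partial P

      attach : ∀ {n} (s : Vec Status (suc n)) {x : Fin (suc n) → V T} {u i} →
               Labeled-𝒪 (joinLabeled L u (labeledPath s) i) →
               IsEmbedding (path (suc n)) T x → (∀ j → st (x j) ≡ lookup s j) →
               f u ~ x i → ¬ Image (x i) → (∀ j → x j ≢ f u) → Partial (k + suc n)
      attach _ {x = x} member′ emb label u~x x∉ u∉ = record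
        { member    = member′
        ; f         = [ f , x ]
        ; embedding = join-embedding _≟_ bridges embedding emb (𝒪-connected member) path-connected
                        u~x (λ v p → x∉ (v , p)) u∉
        ; f-status  = λ { (inj₁ v) → f-status v ; (inj₂ j) → label j }
        ; size      = ↔-trans (size ⊎-↔ ↔-refl) (↔-sym +↔⊎)
        }

      extend : ∀ {u w} → f u ~ w → ¬ Image w → ∃[ j ] Partial (k + suc j)
      extend {u} {w} u~w w∉ = by-status (status L u) refl
        where
        wA : st w ≡ A
        -- A B-neighbour of `f u` would be its mate, which lies in the copy.
        wA = ≢B⇒A λ wB → w∉ (L.mate u , trans (image-mate u) (sym (mate-unique u~w wB)))
        by-status : ∀ s → status L u ≡ s → ∃[ j ] Partial (k + suc j)
        by-status A uA = 2 , attach (A ∷ B ∷ B ∷ [])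
          -- The path xyz required by 𝒪₁ is `mate (mate u)`, `mate u`, `u`.
          (𝒪₁ member (Graph.~-sym (graph L) (L.mate-~ (L.mate u))) (Graph.~-sym (graph L) (L.mate-~ u))
              (L.mate-B (L.mate u)) (L.mate-B u) uA)
          (trail (A ∷ B ∷ B ∷ []) x label (λ { 0F → mate-~ w ; 1F → mate-~ (mate w) }) (λ { 0F () }))
          label u~w w∉ u∉
          where
          x : Vec (V T) 3
          x = w ∷ mate w ∷ mate (mate w) ∷ []
          label : ∀ i → st (lookup x i) ≡ lookup (A ∷ B ∷ B ∷ []) i
          label 0F = wA
          label 1F = mate-B w
          label 2F = mate-B (mate w)
          u∉ : ∀ j → lookup x j ≢ f u
          u∉ j p = contradiction (IsEmbedding.injective longer {suc j} {0F} p) λ ()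
            where
            -- With `f u` put in front the walk still never turns back, so `f u` is not on the new
            -- path.
            longer = trail (A ∷ A ∷ B ∷ B ∷ []) (f u ∷ x)
              (λ { 0F → trans (f-status u) uA ; (suc i) → label i })
              (λ { 0F → u~w ; 1F → mate-~ w ; 2F → mate-~ (mate w) })
              (λ { 0F () ; 1F () })
        by-status B uB = 3 , attach (B ∷ B ∷ A ∷ A ∷ [])
          (𝒪₂ member (L.mate-~ u) uB (L.mate-B u))
          (trail (B ∷ B ∷ A ∷ A ∷ []) x label
            (λ { 0F → ~-sym (mate-~ (mate v)) ; 1F → ~-sym (mate-~ v) ; 2F → ~-sym w~v })
            (λ { 0F () ; 1F () }))
          label u~w w∉ u∉
          where
          v : V T
          v = proj₁ (A-neighbour wA)
          w~v : w ~ v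
          w~v = proj₁ (proj₂ (A-neighbour wA))
          x : Vec (V T) 4
          x = mate (mate v) ∷ mate v ∷ v ∷ w ∷ []
          label : ∀ i → st (lookup x i) ≡ lookup (B ∷ B ∷ A ∷ A ∷ []) i
          label 0F = mate-B (mate v)
          label 1F = mate-B v
          label 2F = proj₂ (proj₂ (A-neighbour wA))
          label 3F = wA
          u∉ : ∀ j → lookup x j ≢ f u
          u∉ = λ { 0F p → distinct 4F p λ () ; 1F p → distinct 3F p λ () ; 2F p → distinct 2F p λ ()
                 ; 3F p → distinct 1F p λ () }
            where
            y : Vec (V T) 5
            y = f u ∷ w ∷ v ∷ mate v ∷ mate (mate v) ∷ []
            -- The new path is read backwards from `w`; preceded by `f u` it is again a simple path.
            longer = trail (B ∷ A ∷ A ∷ B ∷ B ∷ []) y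
              (λ { 0F → trans (f-status u) uB ; 1F → label 3F ; 2F → label 2F ; 3F → label 1F ; 4F → label 0F })
              (λ { 0F → u~w ; 1F → w~v ; 2F → mate-~ v ; 3F → mate-~ (mate v) })
              (λ { 0F () ; 1F () ; 2F () })
            distinct : ∀ i → lookup y i ≡ f u → i ≢ 0F → ⊥
            distinct i p i≢0 = i≢0 (IsEmbedding.injective longer {i} {0F} p)

    exit : ∀ {P : Pred (V T) 0ℓ} → Decidable₁ P → ∀ {u v} → Star _~_ u v → P u → ¬ P v →
           ∃₂ λ s w → s ~ w × P s × ¬ P w
    exit P? ε pu ¬pv = contradiction pu ¬pv
    exit P? (_◅_ {j = w} e es) pu ¬pv with P? w
    ... | yes pw = exit P? es pw ¬pv
    ... | no ¬pw = _ , w , e , pu , ¬pw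

    -- Each extension spends one unit of fuel and adds at least one vertex, so the inequality
    -- persists. Without fuel the copy would have more vertices than `T`.
    grow : ∀ fuel {k} → Partial k → order < k + fuel → T ∈𝒪
    grow zero {k} P n<k = contradiction
      (injection⇒≤ vertices {f = f ∘ Inverse.from size} λ p →
        Injection.injective (↔⇒↣ (↔-sym size)) (IsEmbedding.injective embedding p))
      (ℕ.<⇒≱ (subst (order <_) (ℕ.+-identityʳ k) n<k))
      where open Partial P
    grow (suc fuel) {k} P n<k with search vertices (λ v → ¬? (Partial.image? P v))
    ... | no full = _ , Partial.member P , embedding⇒≅ (Partial.embedding P)
                      λ v → decidable-stable (Partial.image? P v) λ v∉ → full (v , v∉)
    ... | yes (v , v∉) with exit (Partial.image? P) (Connected.reachable connected root v) (_ , refl) v∉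
      where root = Partial.f P (Connected.nonempty (𝒪-connected (Partial.member P)))
    ... | _ , w , s~w , (u , refl) , w∉ with extend P s~w w∉
    ... | j , P′ = grow fuel P′ (ℕ.≤-trans n<k (subst (k + suc fuel ≤_) (sym (ℕ.+-assoc k (suc j) fuel))
                     (ℕ.+-monoʳ-≤ k (s≤s (ℕ.m≤n+m fuel j)))))

  labeling⇒∈𝒪 : T ∈𝒪
  labeling⇒∈𝒪 = grow order seed (s≤s (ℕ.m≤n+m order 5))

-- From 𝒪′ to a labelling

module _ (G : Graph) where
  open Graph G using (_~_)

  Leaf : Pred (V G) 0ℓ
  Leaf x = ∃[ y ] (x ~ y × (∀ {z} → x ~ z → z ≡ y))

  LeafOrSupport : Pred (V G) 0ℓ
  LeafOrSupport x = Leaf x ⊎ (∃[ y ] (x ~ y × Leaf y))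

-- The statuses are determined by the graph alone, so the labellings chosen
-- for two roots of the same component agree.
record LeafLabeling (G : Graph) (st : V G → Status) : Set where
  field
    labeling : Labeling G st
    B⇒leaf   : ∀ {v} → st v ≡ B → LeafOrSupport G v
    leaf⇒B   : ∀ {v} → LeafOrSupport G v → st v ≡ B

module _ {G H : Graph} (iso : G ≅ H) where
  open _≅_ iso
  open Inverse bijection using () renaming (strictlyInverseˡ to to-from; strictlyInverseʳ to from-to)
  private
    module G = Graph G
    module H = Graph H

  leaf-to : ∀ {v} → Leaf G v → Leaf H (to v)
  leaf-to {v} (y , v~y , only) = to y , Equivalence.to ~-iff v~y , λ {z} e →
    trans (sym (to-from z)) (cong to (only (~-pull iso e)))

  leaf-from : ∀ {v} → Leaf H (to v) → Leaf G v
  leaf-from {v} (y , v~y , only) = from y , ~-pull iso v~y , λ {z} e →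
    trans (sym (from-to z)) (cong from (only (Equivalence.to ~-iff e)))

  leafLabeling-≅ : ∀ {st} → LeafLabeling H st → LeafLabeling G (st ∘ to)
  leafLabeling-≅ {st} lab = record
    { labeling = labeling-≅ iso labeling
    ; B⇒leaf   = λ vB → pull (B⇒leaf vB)
    ; leaf⇒B   = λ l → leaf⇒B (push l)
    }
    where
    open LeafLabeling lab
    pull : ∀ {v} → LeafOrSupport H (to v) → LeafOrSupport G v
    pull (inj₁ l)           = inj₁ (leaf-from l)
    pull (inj₂ (y , e , l)) = inj₂ (from y , ~-pull iso e , leaf-from (subst (Leaf H) (sym (to-from y)) l))
    push : ∀ {v} → LeafOrSupport G v → LeafOrSupport H (to v)
    push (inj₁ l)           = inj₁ (leaf-to l)
    push (inj₂ (y , e , l)) = inj₂ (to y , Equivalence.to ~-iff e , leaf-to l)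

-- A walk to some other vertex starts with an edge.
has-neighbour : ∀ {G} (fin : Finite G) → Connected G → 2 ≤ Finite.order fin →
                ∀ v → ∃[ w ] Graph._~_ G v w
has-neighbour {G} fin connected 2≤n v = first (other 2≤n vertices)
  where
  open Finite fin
  other : ∀ {n} → 2 ≤ n → V G ↔ Fin n → ∃[ w ] v ≢ w
  other (s≤s (s≤s _)) V↔n with decEq V↔n v (Inverse.from V↔n 0F)
  ... | no v≢0 = _ , v≢0
  ... | yes refl = Inverse.from V↔n 1F , λ p → contradiction (Injection.injective (↔⇒↣ (↔-sym V↔n)) p) λ ()
  first : ∃[ w ] v ≢ w → ∃[ w ] Graph._~_ G v w
  first (w , v≢w) with Connected.reachable connected v w
  ... | ε     = contradiction refl v≢w
  ... | e ◅ _ = _ , e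

module _ {R : Graph} (𝒫 : NeighborhoodPartitions R)
         (neighbour : ∀ v → ∃[ w ] Graph._~_ R v w) (root : V R) where
  open Graph R using (_~_; ~-sym)
  private
    module 𝒫 v = Partition (𝒫 v)
    D : Graph
    D = 2-subdivision R 𝒫

  subdivisionStatus : SubdivisionVertex R 𝒫 → Status
  subdivisionStatus (original _) = B
  subdivisionStatus (pendant _)  = B
  subdivisionStatus (block _ _)  = A

  someBlock : ∀ v → Fin (𝒫.size v)
  someBlock v = proj₁ (Equivalence.to (𝒫.union v) (proj₂ (neighbour v)))

  blockNeighbour : ∀ v i → ∃₂ λ u j → SubdivisionEdge R 𝒫 (block v i) (block u j)
  blockNeighbour v i =
    let u , u∈i = 𝒫.nonempty v i
        v~u     = Equivalence.from (𝒫.union v) (i , u∈i)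
        j , v∈j = Equivalence.to (𝒫.union u) (~-sym v~u)
    in u , j , E₃ v~u u∈i v∈j

  subdivision-labeling : Labeling D subdivisionStatus
  subdivision-labeling = record
    { mate        = λ { (original v) → pendant v ; (pendant v) → original v ; (block v _) → original v }
    ; mate-~      = λ { (original v) → fwd (E₁ v) ; (pendant v) → bwd (E₁ v) ; (block v i) → bwd (E₂ v i) }
    ; mate-B      = λ { (original v) → refl ; (pendant v) → refl ; (block v i) → refl }
    ; mate-unique = λ { (fwd (E₁ v)) _ → refl ; (bwd (E₁ v)) _ → refl ; (bwd (E₂ v i)) _ → refl
                      ; (fwd (E₂ _ _)) () ; (fwd (E₃ _ _ _)) () ; (bwd (E₃ _ _ _)) () }
    ; A-neighbour = λ { {block v i} _ → let u , j , e = blockNeighbour v i in block u j , fwd e , refl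
                      ; {original _} () ; {pendant _} () }
    ; A-vertex    = block root (someBlock root) , refl
    }

  -- An original vertex is adjacent to its pendant and to some block; a block is adjacent to its
  -- original vertex and to another block.
  leaf⇒pendant : ∀ {x} → Leaf D x → ∃[ v ] x ≡ pendant v
  leaf⇒pendant {pendant v} _ = v , refl
  leaf⇒pendant {original v} (_ , _ , only)
    with trans (only (fwd (E₁ v))) (sym (only (fwd (E₂ v (someBlock v)))))
  ... | ()
  leaf⇒pendant {block v i} (_ , _ , only)
    with trans (only (bwd (E₂ v i))) (sym (only (fwd (proj₂ (proj₂ (blockNeighbour v i))))))
  ... | ()

  pendant-leaf : ∀ v → Leaf D (pendant v)
  pendant-leaf v = original v , bwd (E₁ v) , λ { (bwd (E₁ _)) → refl }

  subdivision-leafLabeling : LeafLabeling D subdivisionStatus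
  subdivision-leafLabeling = record
    { labeling = subdivision-labeling
    ; B⇒leaf   = λ { {original v} _ → inj₂ (pendant v , fwd (E₁ v) , pendant-leaf v)
                   ; {pendant v} _ → inj₁ (pendant-leaf v) ; {block _ _} () }
    ; leaf⇒B   = leaf-B
    }
    where
    leaf-B : ∀ {x} → LeafOrSupport D x → subdivisionStatus x ≡ B
    leaf-B (inj₁ l) with leaf⇒pendant l
    ... | _ , refl = refl
    leaf-B (inj₂ (_ , e , l)) with leaf⇒pendant l
    leaf-B (inj₂ (_ , fwd (E₁ _) , _)) | _ , refl = refl

𝒪′-leafLabeling : ∀ {G} → G ∈𝒪′ → ∃[ st ] LeafLabeling G st
𝒪′-leafLabeling (_ , R , fin , 𝒫 , tree , 2≤n , iso) =
  _ , leafLabeling-≅ iso (subdivision-leafLabeling 𝒫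
        (has-neighbour fin connected 2≤n) (Connected.nonempty connected))
  where open IsTree tree

-- Gluing the labellings of the components

module _ (G : Graph) (r : V G) where

  -- A component contains all neighbours of its vertices, so being a leaf means the same in it as in
  -- the whole graph.
  component-leaf⇒ : ∀ x → Leaf (component G r) x → Leaf G (value x)
  component-leaf⇒ (x , irr rx) ((y , _) , e , only) =
    y , e , λ {z} e′ → cong value (only {z , irr (rx ◅◅ e′ ◅ ε)} e′)

  component-leaf⇐ : ∀ x → Leaf G (value x) → Leaf (component G r) x
  component-leaf⇐ (x , irr rx) (y , e , only) =
    (y , irr (rx ◅◅ e ◅ ε)) , e , λ e′ → value-injective (only e′)

  component-leafOrSupport⇒ : ∀ x → LeafOrSupport (component G r) x → LeafOrSupport G (value x)
  component-leafOrSupport⇒ x (inj₁ l)           = inj₁ (component-leaf⇒ x l)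
  component-leafOrSupport⇒ x (inj₂ (y , e , l)) = inj₂ (value y , e , component-leaf⇒ y l)

  component-leafOrSupport⇐ : ∀ x → LeafOrSupport G (value x) → LeafOrSupport (component G r) x
  component-leafOrSupport⇐ x (inj₁ l) = inj₁ (component-leaf⇐ x l)
  component-leafOrSupport⇐ (_ , irr rx) (inj₂ (y , e , l)) =
    inj₂ ((y , irr (rx ◅◅ e ◅ ε)) , e , component-leaf⇐ (y , irr (rx ◅◅ e ◅ ε)) l)

module _ {T : Graph} (fin : Finite T) (M : Matching T) (root : V T) (every : EveryComponent _∈𝒪′ (T ∓ M)) where
  open Graph T using (_~_)
  open Matching M
  private
    H : Graph
    H = T ∓ M

    module Own (v : V T) where
      st : V (component H (inj₁ v)) → Status
      st = proj₁ (𝒪′-leafLabeling (every (inj₁ v)))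
      open LeafLabeling (proj₂ (𝒪′-leafLabeling (every (inj₁ v)))) public
      open Labeling labeling public
      self : V (component H (inj₁ v))
      self = inj₁ v , irr ε
      near : ∀ {y} → Graph._~_ H (inj₁ v) y → V (component H (inj₁ v))
      near {y} e = y , irr (e ◅ ε)

  -- A labelling is given for each root rather than for each component, so every vertex is read in
  -- the one rooted at itself.
  glued : V T → Status
  glued v = Own.st v (Own.self v)

  private
    own-B⇒ : ∀ v {x} → Own.st v x ≡ B → LeafOrSupport H (value x)
    own-B⇒ v {x} xB = component-leafOrSupport⇒ H (inj₁ v) x (Own.B⇒leaf v xB)

    own-B⇐ : ∀ v {x} → LeafOrSupport H (value x) → Own.st v x ≡ B
    own-B⇐ v {x} l = Own.leaf⇒B v (component-leafOrSupport⇐ H (inj₁ v) x l)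

    own⇒glued : ∀ v {w p} → Own.st v (inj₁ w , p) ≡ B → glued w ≡ B
    own⇒glued v {w} {p} wB = own-B⇐ w {Own.self w} (own-B⇒ v {inj₁ w , p} wB)

    glued⇒own : ∀ v {w p} → glued w ≡ B → Own.st v (inj₁ w , p) ≡ B
    glued⇒own v {w} {p} wB = own-B⇐ v {inj₁ w , p} (own-B⇒ w {Own.self w} wB)

    own-A⇒ : ∀ v {w p} → Own.st v (inj₁ w , p) ≡ A → glued w ≡ A
    own-A⇒ v {w} {p} wA = ≢B⇒A λ wB → contradiction (trans (sym wA) (glued⇒own v {w} {p} wB)) A≢B

    newLeaf : ∀ c → Leaf H (inj₂ c)
    newLeaf c = inj₁ (value c) , refl , λ { {inj₁ _} p → cong inj₁ p }

    newLeaf-B : ∀ v {c p} → Own.st v (inj₂ c , p) ≡ B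
    newLeaf-B v {c} {p} = own-B⇐ v {inj₂ c , p} (inj₁ (newLeaf c))

    -- A covered vertex supports its new leaf.
    covered-B : ∀ {v} → Covered v → glued v ≡ B
    covered-B {v} c = own-B⇐ v {Own.self v} (inj₂ (inj₂ (v , irr c) , refl , newLeaf (v , irr c)))

    -- When the mate of `v` in its component is the new leaf, the partner of `v` in `M` replaces it;
    -- being covered, that partner has status B.
    B-neighbour : ∀ v → ∃[ w ] (v ~ w × glued w ≡ B)
    B-neighbour v with Own.mate v (Own.self v) | Own.mate-~ v (Own.self v) | Own.mate-B v (Own.self v)
    ... | inj₁ w , _ | v~w , _ | wB = w , v~w , own⇒glued v wB
    ... | inj₂ (_ , irr c) , _ | refl | _ =
      let w , vw∈M = recompute (search (Finite.vertices fin) (Edge? v)) c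
      in w , Edge⇒~ vw∈M , covered-B (v , Edge-sym vw∈M)

    -- In its component `u` already has the new leaf as B-neighbour, so `w` would be a second one.
    clash : ∀ {u v w} → Edge u v → u ~ w → ¬ Edge u w → ¬ glued w ≡ B
    clash {u} uv∈M u~w uw∉M wB
      with cong value (Own.mate-cong u {Own.self u}
             {Own.near u (u~w , uw∉M)} {Own.near u {inj₂ (u , irr (_ , uv∈M))} refl}
             (u~w , uw∉M) refl (glued⇒own u wB) (newLeaf-B u))
    ... | ()

    B-unique : ∀ {u v w} → u ~ v → u ~ w → glued v ≡ B → glued w ≡ B → v ≡ w
    B-unique {u} {v} {w} u~v u~w vB wB with Edge? u v | Edge? u w
    ... | yes uv∈M | yes uw∈M = unique uv∈M uw∈M
    ... | no uv∉M | no uw∉M = inj₁-injective (cong value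
      (Own.mate-cong u {Own.self u} {Own.near u (u~v , uv∉M)} {Own.near u (u~w , uw∉M)}
        (u~v , uv∉M) (u~w , uw∉M) (glued⇒own u vB) (glued⇒own u wB)))
    ... | yes uv∈M | no uw∉M = ⊥-elim (clash uv∈M u~w uw∉M wB)
    ... | no uv∉M | yes uw∈M = ⊥-elim (clash uw∈M u~v uv∉M vB)

  glued-labeling : Labeling T glued
  glued-labeling = record
    { mate        = λ v → proj₁ (B-neighbour v)
    ; mate-~      = λ v → proj₁ (proj₂ (B-neighbour v))
    ; mate-B      = λ v → proj₂ (proj₂ (B-neighbour v))
    ; mate-unique = λ {v} v~w wB →
        let _ , v~p , pB = B-neighbour v in B-unique v~w v~p wB pB
    ; A-neighbour = A-nbr
    ; A-vertex    = A-vtx (Own.A-vertex root)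
    }
    where
    A-nbr : ∀ {v} → glued v ≡ A → ∃[ w ] (v ~ w × glued w ≡ A)
    A-nbr {v} vA with Own.A-neighbour v vA
    ... | (inj₁ w , _) , (v~w , _) , wA = w , v~w , own-A⇒ v wA
    ... | (inj₂ _ , _) , _ , cA = contradiction (trans (sym cA) (newLeaf-B v)) A≢B
    A-vtx : (∃[ x ] Own.st root x ≡ A) → ∃[ v ] glued v ≡ A
    A-vtx ((inj₁ w , _) , wA) = w , own-A⇒ root wA
    A-vtx ((inj₂ _ , _) , cA) = contradiction (trans (sym cA) (newLeaf-B root)) A≢B

-- From a labelling to 𝒪′

module Decomposition {T : Graph} (fin : Finite T) (connected : Connected T) (bridges : EveryEdgeBridge T)
                     {st : V T → Status} (labeling : Labeling T st) where

  open Graph T using (_~_; ~-sym; ~-irrefl)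
  open Finite fin using (vertices; _~?_)
  open Labeling labeling

  private
    _≟_ : DecidableEquality (V T)
    _≟_ = decEq vertices

    B≢A : ∀ {u v} → st u ≡ B → st v ≡ A → u ≢ v
    B≢A uB vA refl = A≢B (trans (sym vA) uB)

  HasA : Pred (V T) 0ℓ
  HasA v = ∃[ a ] (v ~ a × st a ≡ A)

  Core : Pred (V T) 0ℓ
  Core v = st v ≡ B × HasA v

  hasA? : Decidable₁ HasA
  hasA? v = search vertices λ a → (v ~? a) ×-dec (st a ≟ₛ A)

  core? : Decidable₁ Core
  core? v = (st v ≟ₛ B) ×-dec hasA? v

  -- `v` and `mate v` are each other's only B-neighbours, so a walk from `v` to an A-vertex leaves
  -- this pair by stepping to status A.
  pair-hasA : ∀ {v} → st v ≡ B → HasA v ⊎ HasA (mate v)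
  pair-hasA {v} vB = go (Connected.reachable connected v (proj₁ A-vertex)) vB
    where
    go : ∀ {v} → Star _~_ v (proj₁ A-vertex) → st v ≡ B → HasA v ⊎ HasA (mate v)
    go ε vB = contradiction (trans (sym (proj₂ A-vertex)) vB) A≢B
    go {v} (_◅_ {j = w} e es) vB with st w ≟ₛ A
    ... | yes wA = inj₁ (w , e , wA)
    ... | no w≢A with mate-unique e (≢A⇒B w≢A)
    ... | refl with go es (mate-B v)
    ...   | inj₁ h = inj₂ h
    ...   | inj₂ h = inj₁ (subst HasA (mate-involutive vB) h)

  M : Matching T
  M = record
    { Edge     = λ u v → u ~ v × Core u × Core v
    ; Edge?    = λ u v → (u ~? v) ×-dec (core? u ×-dec core? v)
    ; Edge-sym = λ (e , cu , cv) → ~-sym e , cv , cu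
    ; Edge⇒~   = proj₁
    ; unique   = λ (u~v , _ , vB , _) (u~w , _ , wB , _) → mate-cong u~v u~w vB wB
    }
  open Matching M using (Edge; Edge?; Covered)

  H : Graph
  H = T ∓ M

  module H = Graph H

  Kept : Rel (V T) 0ℓ
  Kept u v = u ~ v × ¬ Edge u v

  keepˡ : ∀ {u v} → st u ≡ A → u ~ v → Kept u v
  keepˡ uA e = e , λ (_ , (uB , _) , _) → A≢B (trans (sym uA) uB)

  keepʳ : ∀ {u v} → st v ≡ A → u ~ v → Kept u v
  keepʳ vA e = e , λ (_ , _ , (vB , _)) → A≢B (trans (sym vA) vB)

  -- Contracts the new pendant edges. Reachability in `T ∓ M` thereby becomes reachability along
  -- kept edges of `T`, which is decidable because `T` is finite.
  base : V H → V T
  base (inj₁ v) = v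
  base (inj₂ c) = value c

  base-walk : ∀ {x y} → Star H._~_ x y → Star Kept (base x) (base y)
  base-walk ε = ε
  base-walk {inj₁ _} (_◅_ {j = inj₁ _} e es)    = e ◅ base-walk es
  base-walk {inj₁ _} (_◅_ {j = inj₂ _} refl es) = base-walk es
  base-walk {inj₂ _} (_◅_ {j = inj₁ _} refl es) = base-walk es

  to-base : ∀ x → Star H._~_ x (inj₁ (base x))
  to-base (inj₁ v) = ε
  to-base (inj₂ c) = refl ◅ ε

  -- The adjacency of `R`: a will be a block of u and b a block of v.
  record Link (u v : V T) : Set where
    constructor link
    field
      {a b} : V T
      u~a   : u ~ a
      a~b   : a ~ b
      b~v   : b ~ v
      aA    : st a ≡ A
      bA    : st b ≡ A

  link-sym : Symmetric Link
  link-sym (link e f g aA bA) = link (~-sym g) (~-sym f) (~-sym e) bA aA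

  link? : Decidable Link
  link? u v = map′ (λ (_ , _ , e , f , g , aA , bA) → link e f g aA bA)
                   (λ (link e f g aA bA) → _ , _ , e , f , g , aA , bA)
    (search vertices λ a → search vertices λ b →
      (u ~? a) ×-dec (a ~? b) ×-dec (b ~? v) ×-dec (st a ≟ₛ A) ×-dec (st b ≟ₛ A))

  -- Such a link would be a triangle, with a walk round the edge va.
  link-irrefl : ∀ {v} → st v ≡ B → ¬ Link v v
  link-irrefl vB (link {a} {b} v~a a~b b~v aA bA) = bridges v~a
    ( (~-sym b~v , (λ (_ , p) → ~-irrefl (sym p) a~b) , (λ (p , _) → B≢A vB aA p))
    ◅ (~-sym a~b , (λ (p , _) → B≢A vB bA (sym p)) , (λ (_ , p) → B≢A vB aA (sym p)))
    ◅ ε)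

  -- If the first vertices differed, the second link followed by the first one backwards from v to a
  -- would be a walk round the edge ua.
  link-unique : ∀ {u v} → st u ≡ B → st v ≡ B → (l l′ : Link u v) → Link.a l ≡ Link.a l′
  link-unique {u} {v} uB vB l@(link {a} {b} u~a a~b b~v aA bA) (link {a′} {b′} u~a′ a′~b′ b′~v a′A b′A)
    with a ≟ a′
  ... | yes p = p
  ... | no a≢a′ = ⊥-elim (bridges u~a
    ( (u~a′ , (λ (_ , p) → a≢a′ (sym p)) , (λ (p , _) → B≢A uB aA p))
    ◅ (a′~b′ , (λ (p , _) → B≢A uB a′A (sym p)) , (λ (_ , p) → B≢A uB b′A (sym p)))
    ◅ (b′~v , (λ (p , _) → B≢A uB b′A (sym p)) , (λ (_ , p) → u≢v (sym p)))
    ◅ (~-sym b~v , (λ (p , _) → u≢v (sym p)) , (λ (p , _) → B≢A vB aA p))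
    ◅ (~-sym a~b , (λ (p , _) → B≢A uB bA (sym p)) , (λ (_ , p) → B≢A uB aA (sym p)))
    ◅ ε))
    where
    u≢v : u ≢ v
    u≢v refl = link-irrefl uB l

  A-nbrs : ∀ v → ∃[ k ] ([ a ∈ V T ∣ v ~ a × st a ≡ A ] ↔ Fin k)
  A-nbrs v = enumerate vertices λ a → (v ~? a) ×-dec (st a ≟ₛ A)

  -- Only A-neighbours count: this is the number of blocks at a vertex of `R`.
  degree : V T → ℕ
  degree v = proj₁ (A-nbrs v)

  module A-nbrs v = Inverse (proj₂ (A-nbrs v))

  nbr : ∀ v → Fin (degree v) → V T
  nbr v i = value (A-nbrs.from v i)

  nbr-spec : ∀ v i → v ~ nbr v i × st (nbr v i) ≡ A
  nbr-spec v i = satisfies {P = λ a → v ~ a × st a ≡ A} (λ a → (v ~? a) ×-dec (st a ≟ₛ A)) (A-nbrs.from v i)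

  nbr-~ : ∀ v i → v ~ nbr v i
  nbr-~ v i = proj₁ (nbr-spec v i)

  nbr-A : ∀ v i → st (nbr v i) ≡ A
  nbr-A v i = proj₂ (nbr-spec v i)

  nbr-injective : ∀ v → Injective _≡_ _≡_ (nbr v)
  nbr-injective v p = Injection.injective (↔⇒↣ (↔-sym (proj₂ (A-nbrs v)))) (value-injective p)

  nbr-surjective : ∀ {v a} → v ~ a → st a ≡ A → ∃[ i ] nbr v i ≡ a
  nbr-surjective {v} {a} e aA =
    A-nbrs.to v (a , irr (e , aA)) , cong value (A-nbrs.strictlyInverseʳ v (a , irr (e , aA)))

  -- One component of `T ∓ M` as a 2-subdivision

  module _ (r : V H) where

    Near : Pred (V T) 0ℓ
    Near = Star Kept (base r)

    near? : Decidable₁ Near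
    near? = star? vertices (λ u v → (u ~? v) ×-dec ¬? (Edge? u v)) (base r)

    near⇒reachable : ∀ {x} → Near (base x) → Reachable H r x
    near⇒reachable {x} w = to-base r ◅◅ Star.gmap inj₁ id w ◅◅
                           Star.reverse (λ {i} {j} → H.~-sym {i} {j}) (to-base x)

    C : Graph
    C = component H r
    module C = Graph C

    near-value : (x : V C) → Near (base (value x))
    near-value (x , irr rx) = recompute (near? (base x)) (base-walk rx)

    component-connected : Connected C
    component-connected = record
      { nonempty  = r , irr ε
      ; reachable = λ x y → Star.reverse (λ {i} {j} → C.~-sym {i} {j}) (fromRoot x) ◅◅ fromRoot y
      }
      where
      go : ∀ {x y} (rx : Reachable H r x) (w : Star H._~_ x y) → Star C._~_ (x , irr rx) (y , irr (rx ◅◅ w))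
      go rx ε       = ε
      go rx (_◅_ {j = z} e w) = _◅_ {j = z , irr (rx ◅◅ e ◅ ε)} e (go (rx ◅◅ e ◅ ε) w)
      fromRoot : ∀ x → Star C._~_ (r , irr ε) x
      fromRoot x = go ε (near⇒reachable (near-value x))

    no-bypass-from-leaf : ∀ {c p b} → C._~_ (inj₂ c , p) b → ¬ Star (Without C (inj₂ c , p) b) (inj₂ c , p) b
    no-bypass-from-leaf {b = inj₁ _ , _} refl (_◅_ {j = inj₁ _ , _} (refl , ≢₁ , _) _) = ≢₁ (refl , refl)

    -- A walk round a kept edge contracts to a walk in `T` round the same edge; a pendant edge is
    -- the only edge at its new leaf.
    component-bridges : EveryEdgeBridge C
    component-bridges {inj₁ u , p} {inj₁ v , q} (u~v , _) walk = bridges u~v (project walk)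
      where
      project : ∀ {x y} → Star (Without C (inj₁ u , p) (inj₁ v , q)) x y →
                Star (Without T u v) (base (value x)) (base (value y))
      project ε = ε
      project {inj₁ _ , _} (_◅_ {j = inj₁ _ , _} ((e , _) , ≢₁ , ≢₂) es) =
        (e , (λ { (refl , refl) → ≢₁ (refl , refl) }) , (λ { (refl , refl) → ≢₂ (refl , refl) })) ◅ project es
      project {inj₁ _ , _} (_◅_ {j = inj₂ _ , _} (refl , _) es) = project es
      project {inj₂ _ , _} (_◅_ {j = inj₁ _ , _} (refl , _) es) = project es
    component-bridges {inj₂ c , p} {b} e walk = no-bypass-from-leaf {c} {p} {b} e walk
    component-bridges {inj₁ u , p} {inj₂ c , q} e walk =
      no-bypass-from-leaf {c} {q} {inj₁ u , p} e (without-swap {G = C} (without-reverse {G = C} walk))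

    component-tree : IsTree C
    component-tree = record
      { connected = component-connected ; acyclic = bridges⇒acyclic {G = C} component-bridges }

    InR : Pred (V T) 0ℓ
    InR v = Core v × Near v

    inR? : Decidable₁ InR
    inR? v = core? v ×-dec near? v

    R : Graph
    R = record
      { V        = [ v ∈ V T ∣ InR v ]
      ; _~_      = λ u v → Link (value u) (value v)
      ; ~-sym    = link-sym
      ; ~-irrefl = λ { {v} refl → link-irrefl (proj₁ (proj₁ (satisfies inR? v))) }
      }

    module R = Graph R

    core : (v : V R) → Core (value v)
    core v = proj₁ (satisfies inR? v)

    core-B : (v : V R) → st (value v) ≡ B
    core-B v = proj₁ (core v)

    near : (v : V R) → Near (value v)
    near v = proj₂ (satisfies inR? v)

    R-finite : Finite R
    R-finite = record
      { order    = proj₁ (enumerate vertices inR?)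
      ; vertices = proj₂ (enumerate vertices inR?)
      ; _~?_     = λ u v → link? (value u) (value v)
      }

    -- A walk round the link u a b v expands to a walk in `T` round ab: a link is determined by its
    -- middle edge, its ends being the mates of the two A-vertices.
    R-bridges : EveryEdgeBridge R
    R-bridges {u} {v} (link {a} {b} u~a a~b b~v aA bA) walk = bridges a~b
      (avoidʳ (core-B u) (~-sym u~a) ◅ (expand walk ◅◅ avoidˡ (core-B v) (~-sym b~v) ◅ ε))
      where
      avoidˡ : ∀ {x y} → st x ≡ B → x ~ y → Without T a b x y
      avoidˡ xB e = e , (λ (p , _) → B≢A xB aA p) , (λ (p , _) → B≢A xB bA p)
      avoidʳ : ∀ {x y} → st y ≡ B → x ~ y → Without T a b x y
      avoidʳ yB e = e , (λ (_ , p) → B≢A yB bA p) , (λ (_ , p) → B≢A yB aA p)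
      same : ∀ {x} {p q : V R} → x ~ value p → x ~ value q → p ≡ q
      same {p = p} {q} e e′ = value-injective (mate-cong e e′ (core-B p) (core-B q))
      expand : ∀ {p q} → Star (Without R u v) p q → Star (Without T a b) (value p) (value q)
      expand ε = ε
      expand {p} (_◅_ {j = q} (link p~c c~d d~q _ _ , ≢₁ , ≢₂) es) =
        avoidˡ (core-B p) p~c ◅
        (c~d , (λ { (refl , refl) → ≢₁ (same (~-sym p~c) (~-sym u~a) , same d~q b~v) })
             , (λ { (refl , refl) → ≢₂ (same (~-sym p~c) b~v , same d~q (~-sym u~a)) })) ◅
        avoidʳ (core-B q) d~q ◅ expand es

    -- The A-neighbours a of v index the blocks of v: a stands for the block of
    -- the u reached by paths v a b u.
    Block : ∀ v → Fin (degree v) → Pred (V R) 0ℓ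
    Block v i u = ∃[ b ] (nbr v i ~ b × b ~ value u × st b ≡ A)

    block-link : ∀ {v i u} → Block v i u → Link v (value u)
    block-link {v} {i} (_ , e , f , bA) = link (nbr-~ v i) e f (nbr-A v i) bA

    -- From the A-vertex of the block one goes on to an A-neighbour b and its mate, which lies in
    -- `R` because b is an A-neighbour of it.
    inhabitant : ∀ (v : V R) i → ∃[ u ] Block (value v) i u
    inhabitant v i =
      let a = nbr (value v) i
          b , a~b , bA = A-neighbour (nbr-A (value v) i)
          near-a = near v ◅◅ keepʳ (nbr-A (value v) i) (nbr-~ (value v) i) ◅ keepˡ (nbr-A (value v) i) a~b ◅
                   keepˡ bA (mate-~ b) ◅ ε
      in (mate b , irr ((mate-B b , b , ~-sym (mate-~ b) , bA) , near-a)) , b , a~b , mate-~ b , bA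

    𝒫 : NeighborhoodPartitions R
    𝒫 v = record
      { size     = degree (value v)
      ; block    = Block (value v)
      ; nonempty = inhabitant v
      -- A vertex in two blocks would give two links with different first vertices.
      ; disjoint = λ {i} {j} {u} p q → nbr-injective (value v)
          (link-unique (core-B v) (core-B u) (block-link {u = u} p) (block-link {u = u} q))
      ; union    = λ {u} → mk⇔
          (λ (link e f g aA bA) → let i , p = nbr-surjective e aA in
             i , _ , subst (_~ _) (sym p) f , g , bA)
          (λ (i , p) → block-link {u = u} p)
      }

    -- If the mate of v is in R as well, the edge joining them is in M and v has
    -- a new leaf; otherwise the mate is itself the leaf at v.
    data PendantView (v : V T) : V H → Set where
      new : Core (mate v) → (c : Irrelevant (Covered v)) → PendantView v (inj₂ (v , c))
      old : ¬ Core (mate v) → PendantView v (inj₁ (mate v))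

    pendantView : (v : V R) → ∃[ x ] PendantView (value v) x
    pendantView v with core? (mate (value v))
    ... | yes cm = _ , new cm (irr (mate (value v) , mate-~ _ , core v , cm))
    ... | no ¬cm = _ , old ¬cm

    D : Graph
    D = 2-subdivision R 𝒫
    module D = Graph D

    image : V D → V H
    image (original v) = inj₁ (value v)
    image (pendant v)  = proj₁ (pendantView v)
    image (block v i)  = inj₁ (nbr (value v) i)

    image-near : ∀ x → Near (base (image x))
    image-near (original v) = near v
    image-near (pendant v) with pendantView v
    ... | _ , new _ _ = near v
    ... | _ , old ¬cm = near v ◅◅ (mate-~ (value v) , λ (_ , _ , cm) → ¬cm cm) ◅ ε
    image-near (block v i) = near v ◅◅ keepʳ (nbr-A (value v) i) (nbr-~ (value v) i) ◅ ε

    -- Having just one B-neighbour, a block or an old pendant vertex belongs to a single vertex of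
    -- `R`.
    owner≡ : ∀ {x} {u v : V R} → x ~ value u → x ~ value v → u ≡ v
    owner≡ {u = u} {v} e f = value-injective (mate-cong e f (core-B u) (core-B v))

    image-edge : ∀ {x y} → SubdivisionEdge R 𝒫 x y → image x H.~ image y
    image-edge (E₁ v) with pendantView v
    ... | _ , new _ _ = refl
    ... | _ , old ¬cm = mate-~ (value v) , λ (_ , _ , cm) → ¬cm cm
    image-edge (E₂ v i) = keepʳ (nbr-A (value v) i) (nbr-~ (value v) i)
    image-edge (E₃ {u} {v} {i} {j} _ p@(b , a~b , b~v , bA) q) =
      -- Both memberships give a link from v to u; by uniqueness the vertex b of the first is the
      -- block j of v.
      keepˡ (nbr-A (value u) i) (subst (nbr (value u) i ~_)
        (link-unique (core-B v) (core-B u) (link-sym (block-link {u = v} p)) (block-link {u = u} q)) a~b)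

    image-~ : ∀ {x y} → x D.~ y → image x H.~ image y
    image-~ (fwd e) = image-edge e
    image-~ {x} {y} (bwd e) = H.~-sym {image y} {image x} (image-edge e)

    image-~⁻¹ : ∀ x y → image x H.~ image y → x D.~ y
    -- An edge between two core vertices is in `M`, hence deleted.
    image-~⁻¹ (original u) (original v) (e , e∉M) = contradiction (e , core u , core v) e∉M
    image-~⁻¹ (original u) (pendant v) e with pendantView v
    ... | _ , new _ _ with refl ← value-injective {v = u} {w = v} e = fwd (E₁ u)
    ... | _ , old ¬cm with refl ← owner≡ {u = u} {v} (~-sym (proj₁ e)) (~-sym (mate-~ (value v))) = fwd (E₁ u)
    image-~⁻¹ (original u) (block v i) (e , _)
      with refl ← owner≡ {u = u} {v} (~-sym e) (~-sym (nbr-~ (value v) i)) = fwd (E₂ u i)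
    image-~⁻¹ (pendant u) (pendant v) e with pendantView u | pendantView v
    ... | _ , new _ _ | _ , old ¬cm = contradiction (subst Core (sym e) (core u)) ¬cm
    ... | _ , old ¬cm | _ , new _ _ = contradiction (subst Core (sym e) (core v)) ¬cm
    -- `mate v` would be the mate of `mate u`, that is u, which is core.
    ... | _ , old _ | _ , old ¬cm′ = contradiction (subst Core
            (trans (sym (mate-involutive (core-B u))) (sym (mate-unique (proj₁ e) (mate-B _)))) (core u)) ¬cm′
    image-~⁻¹ (pendant u) (block v i) e with pendantView u
    ... | _ , new _ _ = contradiction (sym e) (B≢A (core-B u) (nbr-A (value v) i))
    -- Next to an A-vertex, `mate u` would be core.
    ... | _ , old ¬cm = contradiction (mate-B _ , nbr (value v) i , proj₁ e , nbr-A (value v) i) ¬cm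
    image-~⁻¹ (block u i) (block v j) (e , _) = fwd (E₃
      (link (nbr-~ (value u) i) e (~-sym (nbr-~ (value v) j)) (nbr-A (value u) i) (nbr-A (value v) j))
      (_ , e , ~-sym (nbr-~ (value v) j) , nbr-A (value v) j)
      (_ , ~-sym e , ~-sym (nbr-~ (value u) i) , nbr-A (value u) i))
    image-~⁻¹ x@(pendant _) y@(original _) e = D.~-sym (image-~⁻¹ y x (H.~-sym {image x} {image y} e))
    image-~⁻¹ x@(block _ _) y@(original _) e = D.~-sym (image-~⁻¹ y x (H.~-sym {image x} {image y} e))
    image-~⁻¹ x@(block _ _) y@(pendant _)  e = D.~-sym (image-~⁻¹ y x (H.~-sym {image x} {image y} e))

    image-injective : ∀ x y → image x ≡ image y → x ≡ y
    image-injective (original u) (original v) p = cong original (value-injective (inj₁-injective p))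
    image-injective (original u) (pendant v) p with pendantView v
    ... | _ , old ¬cm = contradiction (subst Core (inj₁-injective p) (core u)) ¬cm
    image-injective (original u) (block v i) p =
      contradiction (inj₁-injective p) (B≢A (core-B u) (nbr-A (value v) i))
    image-injective (pendant u) (pendant v) p with pendantView u | pendantView v
    ... | _ , new _ _ | _ , new _ _ = cong pendant (value-injective (cong value (inj₂-injective p)))
    ... | _ , old _ | _ , old _ = cong pendant (value-injective (trans (sym (mate-involutive (core-B u)))
            (trans (cong mate (inj₁-injective p)) (mate-involutive (core-B v)))))
    image-injective (pendant u) (block v i) p with pendantView u
    ... | _ , old _ = contradiction (inj₁-injective p) (B≢A (mate-B _) (nbr-A (value v) i))
    image-injective (block u i) (block v j) p
      with refl ← owner≡ {u = u} {v} (~-sym (nbr-~ (value u) i))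
                    (subst (_~ value v) (sym (inj₁-injective p)) (~-sym (nbr-~ (value v) j))) =
      cong (block u) (nbr-injective (value u) (inj₁-injective p))
    image-injective x@(pendant _) y@(original _) p = sym (image-injective y x (sym p))
    image-injective x@(block _ _) y@(original _) p = sym (image-injective y x (sym p))
    image-injective x@(block _ _) y@(pendant _)  p = sym (image-injective y x (sym p))

    -- An A-vertex is a block at its mate, a core vertex is original, and a new leaf is the pendant
    -- of the vertex carrying it. Any other B-vertex is the pendant of its mate, which is core by
    -- `pair-hasA`.
    image-surjective : ∀ y → Near (base y) → ∃[ x ] image x ≡ y
    image-surjective (inj₁ w) nw with st w ≟ₛ A
    ... | yes wA =
      let v = mate w
          i , p = nbr-surjective (~-sym (mate-~ w)) wA
      in block (v , irr ((mate-B w , w , ~-sym (mate-~ w) , wA) , nw ◅◅ keepˡ wA (mate-~ w) ◅ ε)) i , cong inj₁ p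
    ... | no w≢A with core? w
    ...   | yes cw = original (w , irr (cw , nw)) , refl
    ...   | no ¬cw = pendant v , image-v
      where
      wB : st w ≡ B
      wB = ≢A⇒B w≢A
      core-mate : Core (mate w)
      core-mate with pair-hasA wB
      ... | inj₁ h = contradiction (wB , h) ¬cw
      ... | inj₂ h = mate-B w , h
      v : V R
      v = mate w , irr (core-mate , nw ◅◅ (mate-~ w , λ (_ , cw , _) → ¬cw cw) ◅ ε)
      image-v : image (pendant v) ≡ inj₁ w
      image-v with pendantView v
      ... | _ , new cm _ = contradiction (subst Core (mate-involutive wB) cm) ¬cw
      ... | _ , old _    = cong inj₁ (mate-involutive wB)
    image-surjective (inj₂ (w , irr c)) nw with recompute (search vertices (Edge? w)) c
    ... | u , w~u , cw , cu = pendant v , image-v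
      where
      v : V R
      v = w , irr (cw , nw)
      image-v : image (pendant v) ≡ inj₂ (w , irr c)
      image-v with pendantView v
      ... | _ , new _ _ = refl
      ... | _ , old ¬cm = contradiction (subst Core (mate-unique w~u (proj₁ cu)) cu) ¬cm

    component≅ : C ≅ D
    component≅ = embedding⇒≅ {f = λ x → image x , irr (near⇒reachable (image-near x))}
      (record { injective = λ {x} {y} p → image-injective x y (cong value p)
              ; ~-to = λ {x} {y} → image-~ {x} {y} ; ~-from = λ {x} {y} → image-~⁻¹ x y })
      λ y → let x , p = image-surjective (value y) (near-value y) in x , value-injective p

    owner : V D → V R
    owner (original v) = v
    owner (pendant v)  = v
    owner (block v _)  = v

    -- Contracting the edges E₁ and E₂ turns walks in the subdivision into walks in `R`, so
    -- connectedness passes from the component to `R`.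
    owner-walk : ∀ {x y} → Star D._~_ x y → Star R._~_ (owner x) (owner y)
    owner-walk ε                         = ε
    owner-walk (fwd (E₁ _) ◅ es)         = owner-walk es
    owner-walk (bwd (E₁ _) ◅ es)         = owner-walk es
    owner-walk (fwd (E₂ _ _) ◅ es)       = owner-walk es
    owner-walk (bwd (E₂ _ _) ◅ es)       = owner-walk es
    owner-walk (fwd (E₃ e _ _) ◅ es)     = e ◅ owner-walk es
    owner-walk (bwd (E₃ {u} {v} e _ _) ◅ es) = R.~-sym {u} {v} e ◅ owner-walk es

    R-connected : Connected R
    R-connected = record
      { nonempty  = owner (to (r , irr ε))
      ; reachable = λ u v → owner-walk (subst₂ (Star D._~_) (to-from (original u)) (to-from (original v))
          (Star.gmap to (λ {x} {y} → Equivalence.to (~-iff {x} {y}))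
            (Connected.reachable component-connected (from (original u)) (from (original v)))))
      }
      where
      open _≅_ component≅
      open Inverse bijection using () renaming (strictlyInverseˡ to to-from)

    component-∈𝒪′ : C ∈𝒪′
    component-∈𝒪′ = component-tree , R , R-finite , 𝒫
      , record { connected = R-connected ; acyclic = bridges⇒acyclic {G = R} R-bridges }
      , 2≤order , component≅
      where
      2≤order : 2 ≤ Finite.order R-finite
      2≤order =
        -- A vertex of `R` and a member of one of its blocks are adjacent, hence distinct.
        let v = Connected.nonempty R-connected
            _ , a , v~a , aA = core v
            i , _ = nbr-surjective v~a aA
            u , p = inhabitant v i
        in distinct⇒2≤ (Finite.vertices R-finite) {v} {u}
             λ v≡u → R.~-irrefl v≡u (block-link {u = u} p)

mainTheorem10 : (T : Graph) (fin : Finite T) → IsTree T → 6 ≤ Finite.order fin →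
    T ∈𝒪 ⇔ (T ∈𝒪′ ⊎ (Σ[ M ∈ Matching T ] EveryComponent _∈𝒪′ (T ∓ M)))
mainTheorem10 T fin tree _ = mk⇔
  (λ (_ , l , iso) → let open Decomposition fin connected bridges (labeling-≅ iso (𝒪-labeling l))
                     in inj₂ (M , component-∈𝒪′))
  (λ { (inj₁ T∈𝒪′) → labeling⇒∈𝒪 fin connected bridges (LeafLabeling.labeling (proj₂ (𝒪′-leafLabeling T∈𝒪′)))
     ; (inj₂ (M , every)) → labeling⇒∈𝒪 fin connected bridges
         (glued-labeling fin M (Connected.nonempty connected) every) })
  where
  open IsTree tree
  bridges : EveryEdgeBridge T
  bridges = acyclic⇒bridges {G = T} (decEq (Finite.vertices fin)) acyclic
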